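{- (i) Let $S\equiv\pm\{1, 6, 7, 8, 9, 11, 12, 13, 16, 17, 19, 23\}\pmod{50}$ and $T\equiv\pm\{1, 5, 6, 7, 8, 11, 15, 17, 18, 19, 23, 24\}\pmod{50}$. Then $p(S,n)=p(T,n-1)$ for all $n\geq 1$. (ii) Let $S\equiv\pm\{1, 3, 4, 5, 7, 15, 17, 18, 19, 21, 22, 24\}\pmod{50}$ and $T\equiv\pm\{1, 2, 3, 7, 11, 14, 17, 18, 19, 21, 23, 24\}\pmod{50}$. Then $p(S,n)=p(T,n-1)$ for all $n\geq 1$. (iii) Let $S\equiv\pm\{1, 3, 4, 5, 7, 9, 12, 13, 15, 16, 21, 22\}\pmod{50}$ and $T\equiv\pm\{1, 3, 4, 6, 7, 8, 9, 13, 17, 19, 21, 22\}\pmod{50}$. Then $p(S,n)=p(T,n)$ for all integers $n\ge0$ with $n\neq 5$. (iv) Let $S\equiv\pm\{2, 3, 5, 9, 11, 12, 13, 14, 15, 16, 21, 23\}\pmod{50}$ and $T\equiv\pm\{1, 3, 7, 9, 11, 12, 13, 16, 18, 21, 23, 24\}\pmod{50}$. Then $p(S,n)=p(T,n-2)$ for all $n\geq 2$. (v) Let $S\equiv\pm\{2, 5, 6, 8, 9, 11, 13, 14, 15, 17, 19, 23\}\pmod{50}$ and $T\equiv\pm\{2, 3, 4, 9, 11, 13, 14, 17, 19, 21, 22, 23\}\pmod{50}$. Then $p(S,n)=p(T,n-2)$ for all $n\geq 2$.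
   Context: For a set $S$ of positive integers and an integer $n\ge 0$, $p(S,n)$ denotes the number of partitions of $n$ into parts belonging to $S$ (so $p(S,0)=1$). The notation $S\equiv\pm\{r_1,\dots,r_k\}\pmod M$ means that $S$ is the set of all positive integers $n$ such that $n\equiv r_i$ or $n\equiv -r_i\pmod M$ for some $i$. -}

module Defs where

open import Data.Nat using (ℕ; zero; suc; _+_; _∸_; _≡ᵇ_; _<ᵇ_)
open import Data.Bool.ListAction using (any)
open import Data.Nat.DivMod using (_%_)
open import Data.Bool using (Bool; true; false; _∨_; if_then_else_)
open import Data.List using (List; []; _∷_)

PosSet : Set
PosSet = ℕ → Bool

-- S ≡ ±{r₁,…,r_k} (mod M): the positive integers n with n ≡ r_i or n ≡ -r_i (mod M).
-- n ≡ -r (mod M)  ⇔  (n + r) % M = 0 , and n ≡ r (mod M) ⇔ n % M = r % M.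
pmSet : (M : ℕ) → List ℕ → PosSet
pmSet zero    rs n = false
pmSet (suc m) rs zero = false
pmSet (suc m) rs n@(suc _) =
  any (λ r → ((n % suc m) ≡ᵇ (r % suc m)) ∨ (((n + r) % suc m) ≡ᵇ 0)) rs

-- pLe S k n : number of partitions of n into parts belonging to S, all parts ≤ k.
-- Recursion on the largest allowed part size k: choose the multiplicity j of the
-- part k+1 (j = 0 if k+1 ∉ S), then partition the rest into parts ≤ k.
pLe : PosSet → ℕ → ℕ → ℕ
pLe S zero    zero    = 1
pLe S zero    (suc n) = 0
pLe S (suc k) n =
  if S (suc k) then multSum n n else pLe S k n
  where
  -- multSum f m = Σ_{j ≥ 0, j·(k+1) ≤ m} pLe S k (m ∸ j·(k+1)), f = fuel ≥ m
  multSum : ℕ → ℕ → ℕ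
  multSum zero     m = pLe S k m
  multSum (suc f)  m =
    pLe S k m + (if m <ᵇ suc k then 0 else multSum f (m ∸ suc k))

p : PosSet → ℕ → ℕ
p S n = pLe S n n

-- With θ±(a) = ∏ (1 ± qⁿ) over n ≡ ±a (mod 25), and with 1/(q^s; q^50) products cleared, each part says
--   ∏_{a ∈ P} θ₊(a) = q^y ∏_{a ∈ Q} θ₊(a) + q^z ∏_{a ∈ C} θ₋(a)
-- for three quadruples P, Q, C: here θ₋(a) θ₊(a) is the product over ±2a (mod 50) of 1 - qⁿ, and θ₋(a)
-- the product over ±a, ±(25 - a) (mod 50). Multiplied by ∏ (1 - q^25n)⁴, each of the three terms becomes
-- a theta series over ℤ⁴ by the Jacobi triple product. Splitting ℤ⁴ by the parity of the coordinate sum,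
-- the six halves are matched by reflections of ℝ⁴ (triality of the D₄ lattice), which is Riemann's
-- quartic theta relation. The series are taken modulo q^N, with N arbitrary, and all products finite.
module Submission where

open import Defs
open import Algebra.Bundles using (CommutativeMonoid; CommutativeSemiring)
open import Algebra.Definitions using (Congruent₂)
open import Algebra.Structures.Biased using (isCommutativeSemiringˡ)
import Algebra.Properties.AbelianGroup as AbelianGroup
import Algebra.Properties.CommutativeSemigroup as Semigroup
import Algebra.Properties.Semiring.Exp as Exp
import Algebra.Solver.Ring.NaturalCoefficients.Default as SemiringSolver
open import Data.Bool using (Bool; true; false; if_then_else_; _∨_)
open import Data.Bool.ListAction using (or)
open import Data.Integer using (ℤ; +_; -[1+_]; _⊖_; 0ℤ; 1ℤ; -1ℤ; ∣_∣)
import Data.Integer as ℤ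
import Data.Integer.Properties as ℤ
import Data.Integer.Tactic.RingSolver as ℤ-Solver
open import Data.List using (List; []; _∷_; _++_; map; applyUpTo; cartesianProduct; filter; filterᵇ; length)
open import Data.List.Membership.Propositional using (_∈_)
open import Data.List.Membership.Propositional.Properties
  using (∈-filter⁺; ∈-filter⁻; ∈-map⁺; ∈-map⁻; ∈-applyUpTo⁺; ∈-cartesianProduct⁺)
open import Data.List.Membership.Propositional.Properties.WithK using (unique∧set⇒bag)
open import Data.List.Properties using (filter-accept; filter-reject; length-map; map-∘; map-cong; map-id-local)
open import Data.List.Relation.Binary.BagAndSetEquality using (∼bag⇒↭)
open import Data.List.Relation.Binary.Permutation.Propositional using (_↭_; ↭-reflexive; ↭-sym; ↭-trans)
import Data.List.Relation.Binary.Permutation.Propositional as ↭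
open import Data.List.Relation.Binary.Permutation.Propositional.Properties using (↭-length)
open import Data.List.Relation.Unary.All as All using (All; []; _∷_; all?)
open import Data.List.Relation.Unary.All.Properties using (all-filter)
open import Data.List.Relation.Unary.Unique.Propositional using (Unique)
import Data.List.Relation.Unary.Unique.Propositional.Properties as Unique
open import Data.Nat using (ℕ; zero; suc; _∸_; _≤_; _<_; z≤n; s≤s; _≤?_; _<ᵇ_; _≡ᵇ_; ⌊_/2⌋)
import Data.Nat as ℕ
open import Data.Nat.DivMod using (_%_; [m+kn]%n≡m%n)
import Data.Nat.Properties as ℕ
import Data.Nat.Tactic.RingSolver as ℕ-Solver
open import Data.List.Sort.Base ℕ.≤-totalOrder using (SortingAlgorithm)
open import Data.List.Sort.MergeSort ℕ.≤-decTotalOrder using (mergeSort)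
open import Data.Product using (_×_; _,_; proj₁; proj₂)
open import Data.Sum using (_⊎_; inj₁; inj₂)
open import Function using (_∘_; mk⇔)
open import Level using (0ℓ)
open import Relation.Binary using (IsEquivalence; Rel)
open import Relation.Binary.PropositionalEquality using (_≡_; _≢_; refl; sym; trans; cong; cong₂; subst; module ≡-Reasoning)
import Relation.Binary.Reasoning.Setoid as SetoidReasoning
open import Relation.Nullary using (Dec; yes; no; ¬_; contradiction)
open import Relation.Nullary.Decidable using (True; toWitness; _×-dec_)
open import Relation.Unary using (Decidable)

open AbelianGroup ℤ.+-0-abelianGroup using (∙-cancelˡ; ∙-cancelʳ)
open SortingAlgorithm mergeSort using (sort; sort-↭)

-- Finite sums and products

-- The target is G_S = q^y G_T + q^z for the generating functions of `p`. The stray monomial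
-- explains the range of n: in (i), (ii), (iv), (v) it has z = 0, which n ≥ y > 0 excludes, while
-- (iii) has y = 0 and z = 5, whence n ≠ 5. The signs of θ₋ make the C series its even half minus
-- its odd half. One half of P is matched with the even half of C, the other with a half of Q, and
-- the remaining half of Q with the odd half of C; so the last two cancel in Q + C and what is left
-- is P. Only the match of P with Q is the bare reflection in (1, 1, 1, 1). The two matches with C
-- also change the sign of a first coordinate, which swaps r and 25 - r and so leaves the theta
-- products alone. In all five cases P and Q share two residues up to this swap, so each relation is
-- a product formula for a difference of two products of two theta functions.

module BigOperators {c ℓ} (M : CommutativeMonoid c ℓ) where
  open CommutativeMonoid M renaming (refl to ≈-refl; sym to ≈-sym; trans to ≈-trans)
  open Semigroup commutativeSemigroup using (interchange; x∙yz≈y∙xz)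
  open SetoidReasoning setoid

  ⨁ : ∀ {a} {A : Set a} → List A → (A → Carrier) → Carrier
  ⨁ []       f = ε
  ⨁ (x ∷ xs) f = f x ∙ ⨁ xs f

  ⨁< : ℕ → (ℕ → Carrier) → Carrier
  ⨁< zero    f = ε
  ⨁< (suc n) f = ⨁< n f ∙ f n

  module _ {a} {A : Set a} where

    ⨁-cong : ∀ (xs : List A) {f g} → (∀ x → f x ≈ g x) → ⨁ xs f ≈ ⨁ xs g
    ⨁-cong []       eq = ≈-refl
    ⨁-cong (x ∷ xs) eq = ∙-cong (eq x) (⨁-cong xs eq)

    ⨁-++ : ∀ (xs ys : List A) f → ⨁ (xs ++ ys) f ≈ ⨁ xs f ∙ ⨁ ys f
    ⨁-++ []       ys f = ≈-sym (identityˡ _)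
    ⨁-++ (x ∷ xs) ys f = ≈-trans (∙-congˡ (⨁-++ xs ys f)) (≈-sym (assoc _ _ _))

    ⨁-↭ : ∀ {xs ys : List A} f → xs ↭ ys → ⨁ xs f ≈ ⨁ ys f
    ⨁-↭ f ↭.refl                  = ≈-refl
    ⨁-↭ f (↭.prep x xs↭ys)        = ∙-congˡ (⨁-↭ f xs↭ys)
    ⨁-↭ f (↭.swap x y xs↭ys)      = ≈-trans (x∙yz≈y∙xz _ _ _) (∙-congˡ (∙-congˡ (⨁-↭ f xs↭ys)))
    ⨁-↭ f (↭.trans xs↭ys ys↭zs)   = ≈-trans (⨁-↭ f xs↭ys) (⨁-↭ f ys↭zs)

    ⨁-filter : ∀ (p : A → Bool) xs f →
               ⨁ xs (λ x → if p x then f x else ε) ≈ ⨁ (filterᵇ p xs) f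
    ⨁-filter p []       f = ≈-refl
    ⨁-filter p (x ∷ xs) f with p x
    ... | true  = ∙-congˡ (⨁-filter p xs f)
    ... | false = ≈-trans (identityˡ _) (⨁-filter p xs f)

  ⨁-map : ∀ {a b} {A : Set a} {B : Set b} (h : A → B) xs f → ⨁ (map h xs) f ≈ ⨁ xs (f ∘ h)
  ⨁-map h []       f = ≈-refl
  ⨁-map h (x ∷ xs) f = ∙-congˡ (⨁-map h xs f)

  ⨁<-cong : ∀ n {f g} → (∀ i → f i ≈ g i) → ⨁< n f ≈ ⨁< n g
  ⨁<-cong zero    eq = ≈-refl
  ⨁<-cong (suc n) eq = ∙-cong (⨁<-cong n eq) (eq n)

  ⨁<-∙ : ∀ n f g → ⨁< n (λ i → f i ∙ g i) ≈ ⨁< n f ∙ ⨁< n g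
  ⨁<-∙ zero    f g = ≈-sym (identityˡ ε)
  ⨁<-∙ (suc n) f g = ≈-trans (∙-congʳ (⨁<-∙ n f g)) (interchange _ _ _ _)

  ⨁<-head : ∀ n f → ⨁< (suc n) f ≈ f 0 ∙ ⨁< n (f ∘ suc)
  ⨁<-head zero    f = comm _ _
  ⨁<-head (suc n) f = ≈-trans (∙-congʳ (⨁<-head n f)) (assoc _ _ _)

  ⨁<-⨁-applyUpTo : ∀ {a} {A : Set a} (g : ℕ → A) n f → ⨁< n (f ∘ g) ≈ ⨁ (applyUpTo g n) f
  ⨁<-⨁-applyUpTo g zero    f = ≈-refl
  ⨁<-⨁-applyUpTo g (suc n) f = ≈-trans (⨁<-head n (f ∘ g)) (∙-congˡ (⨁<-⨁-applyUpTo (g ∘ suc) n f))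

  ⨁<-unit : ∀ k n {f} → (∀ i → n ≤ i → f i ≈ ε) → ⨁< (k ℕ.+ n) f ≈ ⨁< n f
  ⨁<-unit zero    n eq = ≈-refl
  ⨁<-unit (suc k) n eq =
    ≈-trans (∙-cong (⨁<-unit k n eq) (eq (k ℕ.+ n) (ℕ.m≤n+m n k))) (identityʳ _)

  ⨁<-+ : ∀ k n f → ⨁< (k ℕ.+ n) f ≈ ⨁< n f ∙ ⨁< k (λ i → f (i ℕ.+ n))
  ⨁<-+ zero    n f = ≈-sym (identityʳ _)
  ⨁<-+ (suc k) n f = ≈-trans (∙-congʳ (⨁<-+ k n f)) (assoc _ _ _)

  -- Used twice: to regroup progressions modulo 25 into blocks modulo 50, and to sort the integers
  -- 1, ..., 50 N by residue.
  ⨁<-* : ∀ m n f → ⨁< (m ℕ.* n) f ≈ ⨁< m (λ j → ⨁< n (λ i → f (i ℕ.+ j ℕ.* n)))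
  ⨁<-* zero    n f = ≈-refl
  ⨁<-* (suc m) n f = ≈-trans (⨁<-+ n (m ℕ.* n) f) (∙-congʳ (⨁<-* m n f))

module BigSums {c ℓ} (R : CommutativeSemiring c ℓ) where
  open CommutativeSemiring R renaming (refl to ≈-refl; sym to ≈-sym; trans to ≈-trans)

  open BigOperators +-commutativeMonoid public using ()
    renaming (⨁ to ∑; ⨁-cong to ∑-cong; ⨁-map to ∑-map)

  *-distribˡ-∑ : ∀ {a} {A : Set a} y (xs : List A) f → y * ∑ xs f ≈ ∑ xs (λ x → y * f x)
  *-distribˡ-∑ y []       f = zeroʳ y
  *-distribˡ-∑ y (x ∷ xs) f = ≈-trans (distribˡ y _ _) (+-congˡ (*-distribˡ-∑ y xs f))

  ∑-*-∑ : ∀ {a b} {A : Set a} {B : Set b} (xs : List A) (ys : List B) f g →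
          ∑ xs f * ∑ ys g ≈ ∑ (cartesianProduct xs ys) (λ p → f (proj₁ p) * g (proj₂ p))
  ∑-*-∑ []       ys f g = zeroˡ _
  ∑-*-∑ (x ∷ xs) ys f g = ≈-trans (distribʳ _ _ _) (≈-trans
    (+-cong (≈-trans (*-distribˡ-∑ (f x) ys g) (≈-sym (∑-map (x ,_) ys _))) (∑-*-∑ xs ys f g))
    (≈-sym (BigOperators.⨁-++ +-commutativeMonoid (map (x ,_) ys) _ _)))

-- The finite Jacobi triple product

module JacobiTriple {c ℓ} (R : CommutativeSemiring c ℓ) where
  open CommutativeSemiring R renaming (refl to ≈-refl; sym to ≈-sym; trans to ≈-trans)
  open Exp semiring using (_^_; ^-homo-*)
  open SetoidReasoning setoid
  open SemiringSolver R using (solve; _:=_; _:+_; _:*_; con)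

  -- Summing over i + j = n keeps both indices natural numbers, so that no subtraction and no
  -- out-of-range binomial coefficient occurs.
  antidiagonal : ℕ → (ℕ → ℕ → Carrier) → Carrier
  antidiagonal zero    F = F 0 0
  antidiagonal (suc n) F = F 0 (suc n) + antidiagonal n (F ∘ suc)

  antidiagonal-cong : ∀ n {F G} → (∀ i j → i ℕ.+ j ≡ n → F i j ≈ G i j) →
                      antidiagonal n F ≈ antidiagonal n G
  antidiagonal-cong zero    eq = eq 0 0 refl
  antidiagonal-cong (suc n) eq =
    +-cong (eq 0 (suc n) refl) (antidiagonal-cong n (λ i j i+j≡n → eq (suc i) j (cong suc i+j≡n)))

  antidiagonal-+ : ∀ n F G → antidiagonal n (λ i j → F i j + G i j) ≈ antidiagonal n F + antidiagonal n G
  antidiagonal-+ zero    F G = ≈-refl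
  antidiagonal-+ (suc n) F G = ≈-trans (+-congˡ (antidiagonal-+ n _ _))
    (solve 4 (λ a b c d → (a :+ b) :+ (c :+ d) := (a :+ c) :+ (b :+ d)) ≈-refl _ _ _ _)

  antidiagonal-* : ∀ n y F → y * antidiagonal n F ≈ antidiagonal n (λ i j → y * F i j)
  antidiagonal-* zero    y F = ≈-refl
  antidiagonal-* (suc n) y F = ≈-trans (distribˡ y _ _) (+-congˡ (antidiagonal-* n y _))

  antidiagonal-last : ∀ n F → antidiagonal (suc n) F ≈ antidiagonal n (λ i j → F i (suc j)) + F (suc n) 0
  antidiagonal-last zero    F = ≈-refl
  antidiagonal-last (suc n) F = ≈-trans (+-congˡ (antidiagonal-last n (F ∘ suc))) (≈-sym (+-assoc _ _ _))

  antidiagonal-swap : ∀ n F → antidiagonal n F ≈ antidiagonal n (λ i j → F j i)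
  antidiagonal-swap zero    F = ≈-refl
  antidiagonal-swap (suc n) F = begin
    F 0 (suc n) + antidiagonal n (F ∘ suc)             ≈⟨ +-comm _ _ ⟩
    antidiagonal n (F ∘ suc) + F 0 (suc n)             ≈⟨ +-congʳ (antidiagonal-swap n _) ⟩
    antidiagonal n (λ i j → F (suc j) i) + F 0 (suc n) ≈⟨ antidiagonal-last n (λ i j → F j i) ⟨
    antidiagonal (suc n) (λ i j → F j i)               ∎

  module _ (X : Carrier) where

    pochhammer : Carrier → ℕ → Carrier
    pochhammer y zero    = 1#
    pochhammer y (suc r) = pochhammer y r * (1# + y * X ^ r)

    -- The q-binomial coefficient of i + j over i, at q = X.
    gaussian : ℕ → ℕ → Carrier
    gaussian zero    j       = 1#
    gaussian (suc i) zero    = 1#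
    gaussian (suc i) (suc j) = gaussian (suc i) j + X ^ suc j * gaussian i (suc j)

    gaussian-zeroʳ : ∀ i → gaussian i 0 ≈ 1#
    gaussian-zeroʳ zero    = ≈-refl
    gaussian-zeroʳ (suc i) = ≈-refl

    -- Exchanging i and j turns the defining Pascal rule into this one; having both is what makes
    -- `gaussian` symmetric.
    gaussian-pascal : ∀ i j → gaussian (suc i) (suc j) ≈ gaussian i (suc j) + X ^ suc i * gaussian (suc i) j
    gaussian-pascal zero zero = ≈-refl
    gaussian-pascal zero (suc j) = begin
      gaussian 1 (suc j) + X ^ suc (suc j) * 1#
        ≈⟨ +-congʳ (gaussian-pascal 0 j) ⟩
      (1# + X ^ 1 * gaussian 1 j) + X ^ suc (suc j) * 1#
        ≈⟨ solve 3 (λ x y g → (con 1 :+ (x :* con 1) :* g) :+ (x :* y) :* con 1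
             := con 1 :+ (x :* con 1) :* (g :+ y :* con 1)) ≈-refl X (X ^ suc j) (gaussian 1 j) ⟩
      1# + X ^ 1 * (gaussian 1 j + X ^ suc j * 1#) ∎
    gaussian-pascal (suc i) zero = begin
      1# + X ^ 1 * gaussian (suc i) 1
        ≈⟨ +-congˡ (*-congˡ (gaussian-pascal i 0)) ⟩
      1# + X ^ 1 * (gaussian i 1 + X ^ suc i * 1#)
        ≈⟨ solve 3 (λ x y g → con 1 :+ (x :* con 1) :* (g :+ y :* con 1)
             := (con 1 :+ (x :* con 1) :* g) :+ (x :* y) :* con 1) ≈-refl X (X ^ suc i) (gaussian i 1) ⟩
      gaussian (suc i) 1 + X ^ suc (suc i) * 1# ∎
    gaussian-pascal (suc i) (suc j) = begin
      gaussian (suc (suc i)) (suc j) + X ^ suc (suc j) * gaussian (suc i) (suc (suc j))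
        ≈⟨ +-cong (gaussian-pascal (suc i) j) (*-congˡ (gaussian-pascal i (suc j))) ⟩
      (g₀ + X * x * g₁) + X * y * (g₂ + x * g₀)
        ≈⟨ solve 6 (λ X x y g₀ g₁ g₂ → (g₀ :+ X :* x :* g₁) :+ X :* y :* (g₂ :+ x :* g₀)
             := (g₀ :+ X :* y :* g₂) :+ X :* x :* (g₁ :+ y :* g₀)) ≈-refl X x y g₀ g₁ g₂ ⟩
      (g₀ + X * y * g₂) + X * x * (g₁ + y * g₀) ∎
      where
      x = X ^ suc i
      y = X ^ suc j
      g₀ = gaussian (suc i) (suc j)
      g₁ = gaussian (suc (suc i)) j
      g₂ = gaussian i (suc (suc j))

    gaussian-sym : ∀ i j → gaussian i j ≈ gaussian j i
    gaussian-sym zero    j       = ≈-sym (gaussian-zeroʳ j)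
    gaussian-sym (suc i) zero    = ≈-refl
    gaussian-sym (suc i) (suc j) = begin
      gaussian (suc i) (suc j)                         ≈⟨ gaussian-pascal i j ⟩
      gaussian i (suc j) + X ^ suc i * gaussian (suc i) j
        ≈⟨ +-cong (gaussian-sym i (suc j)) (*-congˡ (gaussian-sym (suc i) j)) ⟩
      gaussian (suc j) (suc i) ∎

    -- With ε = -1, pochhammer (ε * X) n is the q-factorial (1 - X)(1 - X²)⋯(1 - Xⁿ).
    gaussian-factorial : ∀ {ε} → 1# + ε ≈ 0# → ∀ i j →
      gaussian i j * (pochhammer (ε * X) i * pochhammer (ε * X) j) ≈ pochhammer (ε * X) (i ℕ.+ j)
    gaussian-factorial ε≈-1 zero    j = ≈-trans (*-identityˡ _) (*-identityˡ _)
    gaussian-factorial {ε} ε≈-1 (suc i) zero = begin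
      1# * (φ (suc i) * 1#) ≈⟨ solve 1 (λ a → con 1 :* (a :* con 1) := a) ≈-refl _ ⟩
      φ (suc i)             ≡⟨ cong (pochhammer (ε * X)) (ℕ.+-identityʳ (suc i)) ⟨
      φ (suc i ℕ.+ 0)       ∎
      where φ = pochhammer (ε * X)
    gaussian-factorial {ε} ε≈-1 (suc i) (suc j) = begin
      (g₁ + X * y * g₂) * ((pᵢ * (1# + ε * X * x)) * (pⱼ * (1# + ε * X * y)))
        ≈⟨ solve 9 (λ X x y ε e g₁ g₂ pᵢ pⱼ →
             (g₁ :+ X :* y :* g₂) :* ((pᵢ :* (con 1 :+ ε :* X :* x)) :* (pⱼ :* (con 1 :+ ε :* X :* y)))
             := (g₁ :* ((pᵢ :* (con 1 :+ ε :* X :* x)) :* pⱼ)) :* (con 1 :+ ε :* X :* y)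
               :+ (g₂ :* (pᵢ :* (pⱼ :* (con 1 :+ ε :* X :* y)))) :* (X :* y :* (con 1 :+ ε :* X :* x)))
             ≈-refl X x y ε (1# + ε) g₁ g₂ pᵢ pⱼ ⟩
      (g₁ * (φ (suc i) * pⱼ)) * (1# + ε * X * y) + (g₂ * (pᵢ * φ (suc j))) * (X * y * (1# + ε * X * x))
        ≈⟨ +-cong (*-congʳ (gaussian-factorial ε≈-1 (suc i) j)) (*-congʳ (gaussian-factorial ε≈-1 i (suc j))) ⟩
      φ (suc i ℕ.+ j) * (1# + ε * X * y) + φ (i ℕ.+ suc j) * (X * y * (1# + ε * X * x))
        ≡⟨ cong (λ n → φ (suc i ℕ.+ j) * (1# + ε * X * y) + φ n * (X * y * (1# + ε * X * x))) (ℕ.+-suc i j) ⟩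
      φ (suc i ℕ.+ j) * (1# + ε * X * y) + φ (suc i ℕ.+ j) * (X * y * (1# + ε * X * x))
        ≈⟨ solve 5 (λ P X x y ε → P :* (con 1 :+ ε :* X :* y) :+ P :* (X :* y :* (con 1 :+ ε :* X :* x))
             := (con 1 :+ ε) :* (P :* X :* y) :+ P :* (con 1 :+ ε :* X :* (X :* x :* y)))
             ≈-refl (φ (suc i ℕ.+ j)) X x y ε ⟩
      (1# + ε) * (φ (suc i ℕ.+ j) * X * y) + φ (suc i ℕ.+ j) * (1# + ε * X * (X * x * y))
        ≈⟨ +-cong (≈-trans (*-congʳ ε≈-1) (zeroˡ _))
                  (*-congˡ (+-congˡ (*-congˡ (≈-sym (^-homo-* X (suc i) j))))) ⟩
      0# + φ (suc i ℕ.+ j) * (1# + ε * X * X ^ (suc i ℕ.+ j))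
        ≈⟨ +-identityˡ _ ⟩
      φ (suc (suc i ℕ.+ j))
        ≡⟨ cong (φ ∘ suc) (ℕ.+-suc i j) ⟨
      φ (suc (i ℕ.+ suc j)) ∎
      where
      φ = pochhammer (ε * X)
      x = X ^ i
      y = X ^ j
      g₁ = gaussian (suc i) j
      g₂ = gaussian i (suc j)
      pᵢ = φ i
      pⱼ = φ j

    antidiagonal-pascal : ∀ n (h : ℕ → Carrier) → antidiagonal (suc n) (λ i j → gaussian i j * h i) ≈
      antidiagonal n (λ i j → gaussian i j * h i) + antidiagonal n (λ i j → X ^ j * gaussian i j * h (suc i))
    antidiagonal-pascal n h = begin
      1# * h 0 + antidiagonal n (λ i j → gaussian (suc i) j * h (suc i))
        ≈⟨ +-congˡ (≈-trans (antidiagonal-cong n (λ i j _ → pascal₀ i j)) (antidiagonal-+ n _ _)) ⟩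
      1# * h 0 + (antidiagonal n (λ i j → gaussian⁻ (suc i) j * h (suc i)) + S)
        ≈⟨ +-assoc _ _ _ ⟨
      antidiagonal (suc n) (λ i j → gaussian⁻ i j * h i) + S
        ≈⟨ +-congʳ (antidiagonal-last n (λ i j → gaussian⁻ i j * h i)) ⟩
      (antidiagonal n (λ i j → gaussian i j * h i) + 0# * h (suc n)) + S
        ≈⟨ +-congʳ (≈-trans (+-congˡ (zeroˡ _)) (+-identityʳ _)) ⟩
      antidiagonal n (λ i j → gaussian i j * h i) + S ∎
      where
      -- The coefficient at j - 1, with value 0 at j = 0. It extends Pascal's rule to the boundary
      -- that the recursion of `gaussian` leaves out, and the extra summand at the far end of the
      -- diagonal vanishes.
      gaussian⁻ : ℕ → ℕ → Carrier
      gaussian⁻ i zero    = 0#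
      gaussian⁻ i (suc j) = gaussian i j
      S = antidiagonal n (λ i j → X ^ j * gaussian i j * h (suc i))
      pascal₀ : ∀ i j → gaussian (suc i) j * h (suc i) ≈
                gaussian⁻ (suc i) j * h (suc i) + X ^ j * gaussian i j * h (suc i)
      pascal₀ i zero    = begin
        1# * h (suc i)                                       ≈⟨ *-congʳ (gaussian-zeroʳ i) ⟨
        gaussian i 0 * h (suc i)
          ≈⟨ solve 2 (λ g x → g :* x := con 0 :* x :+ con 1 :* g :* x) ≈-refl (gaussian i 0) (h (suc i)) ⟩
        0# * h (suc i) + 1# * gaussian i 0 * h (suc i) ∎
      pascal₀ i (suc j) = distribʳ _ _ _

    -- a^(j(j+1)/2) b^(j(j-1)/2) in the case X = a b.
    thetaPower : Carrier → ℕ → Carrier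
    thetaPower a zero    = 1#
    thetaPower a (suc j) = a * X ^ j * thetaPower a j

    thetaTerm : Carrier → Carrier → ℤ → Carrier
    thetaTerm a b (+ j)    = thetaPower a j
    thetaTerm a b -[1+ j ] = thetaPower b (suc j)

    -- Pascal's rule absorbs one more factor as soon as the weights h have the right ratio. This is
    -- the induction step of both the q-binomial theorem and the triple product.
    pochhammer-step : ∀ (a : Carrier) n r (h : ℕ → Carrier) → (∀ i j → i ℕ.+ j ≡ n → X ^ j * h (suc i) ≈ a * X ^ r * h i) →
      antidiagonal n (λ i j → gaussian i j * h i) * (1# + a * X ^ r) ≈
      antidiagonal (suc n) (λ i j → gaussian i j * h i)
    pochhammer-step a n r h eq = begin
      S * (1# + a * X ^ r)
        ≈⟨ solve 2 (λ s y → s :* (con 1 :+ y) := s :+ y :* s) ≈-refl S (a * X ^ r) ⟩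
      S + a * X ^ r * S
        ≈⟨ +-congˡ (antidiagonal-* n _ _) ⟩
      S + antidiagonal n (λ i j → a * X ^ r * (gaussian i j * h i))
        ≈⟨ +-congˡ (antidiagonal-cong n λ i j i+j≡n → begin
             a * X ^ r * (gaussian i j * h i)
               ≈⟨ solve 3 (λ y g z → y :* (g :* z) := g :* (y :* z)) ≈-refl _ _ _ ⟩
             gaussian i j * (a * X ^ r * h i)
               ≈⟨ *-congˡ (eq i j i+j≡n) ⟨
             gaussian i j * (X ^ j * h (suc i))
               ≈⟨ solve 3 (λ y g z → g :* (y :* z) := y :* g :* z) ≈-refl _ _ _ ⟩
             X ^ j * gaussian i j * h (suc i) ∎) ⟩
      S + antidiagonal n (λ i j → X ^ j * gaussian i j * h (suc i))
        ≈⟨ antidiagonal-pascal n h ⟨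
      antidiagonal (suc n) (λ i j → gaussian i j * h i) ∎
      where S = antidiagonal n (λ i j → gaussian i j * h i)

    module _ (a b : Carrier) (ab≈X : a * b ≈ X) where

      -- The term at k + 1 is a X^k times the term at k. With k = i - s the hypothesis says j + k =
      -- r; the extra factor X^j keeps the powers of X nonnegative, and for negative k the relation
      -- a b = X does the work.
      thetaTerm-step : ∀ i j r s → i ℕ.+ j ≡ r ℕ.+ s →
        X ^ j * thetaTerm a b (suc i ⊖ s) ≈ a * X ^ r * thetaTerm a b (i ⊖ s)
      thetaTerm-step i j r zero eq = begin
        X ^ j * (a * X ^ i * t)
          ≈⟨ solve 4 (λ x y a t → x :* (a :* y :* t) := a :* (y :* x) :* t) ≈-refl (X ^ j) (X ^ i) a t ⟩
        a * (X ^ i * X ^ j) * t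
          ≈⟨ *-congʳ (*-congˡ (^-homo-* X i j)) ⟨
        a * X ^ (i ℕ.+ j) * t
          ≡⟨ cong (λ n → a * X ^ n * t) (trans eq (ℕ.+-identityʳ r)) ⟩
        a * X ^ r * t ∎
        where t = thetaPower a i
      thetaTerm-step zero j r (suc s) refl = begin
        X ^ (r ℕ.+ suc s) * thetaTerm a b (1 ⊖ suc s)
          ≡⟨ cong₂ (λ n k → X ^ n * thetaTerm a b k) (ℕ.+-suc r s) (ℤ.[1+m]⊖[1+n]≡m⊖n 0 s) ⟩
        X * X ^ (r ℕ.+ s) * thetaTerm a b (0 ⊖ s)
          ≈⟨ *-cong (*-cong ab≈X (≈-sym (^-homo-* X r s))) (reflexive′ s) ⟨
        a * b * (X ^ r * X ^ s) * thetaPower b s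
          ≈⟨ solve 5 (λ a b x y t → a :* b :* (x :* y) :* t := a :* x :* (b :* y :* t)) ≈-refl a b (X ^ r) (X ^ s) (thetaPower b s) ⟩
        a * X ^ r * (b * X ^ s * thetaPower b s) ∎
        where
        reflexive′ : ∀ s → thetaPower b s ≈ thetaTerm a b (0 ⊖ s)
        reflexive′ zero    = ≈-refl
        reflexive′ (suc s) = ≈-refl
      thetaTerm-step (suc i) j r (suc s) eq = begin
        X ^ j * thetaTerm a b (suc (suc i) ⊖ suc s)
          ≡⟨ cong (λ k → X ^ j * thetaTerm a b k) (ℤ.[1+m]⊖[1+n]≡m⊖n (suc i) s) ⟩
        X ^ j * thetaTerm a b (suc i ⊖ s)
          ≈⟨ thetaTerm-step i j r s (ℕ.suc-injective (trans eq (ℕ.+-suc r s))) ⟩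
        a * X ^ r * thetaTerm a b (i ⊖ s)
          ≡⟨ cong (λ k → a * X ^ r * thetaTerm a b k) (ℤ.[1+m]⊖[1+n]≡m⊖n i s) ⟨
        a * X ^ r * thetaTerm a b (suc i ⊖ suc s) ∎

    -- The q-binomial theorem, which is the case r = 0 of the triple product.
    pochhammer-expansion : ∀ b s → pochhammer b s ≈ antidiagonal s (λ i j → gaussian i j * thetaPower b i)
    pochhammer-expansion b zero    = ≈-sym (*-identityˡ _)
    pochhammer-expansion b (suc s) = ≈-trans (*-congʳ (pochhammer-expansion b s))
      (pochhammer-step b s s (thetaPower b) λ i j i+j≡s → begin
        X ^ j * (b * X ^ i * thetaPower b i)
          ≈⟨ solve 4 (λ x y a t → x :* (a :* y :* t) := a :* (y :* x) :* t) ≈-refl _ _ _ _ ⟩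
        b * (X ^ i * X ^ j) * thetaPower b i
          ≈⟨ *-congʳ (*-congˡ (^-homo-* X i j)) ⟨
        b * X ^ (i ℕ.+ j) * thetaPower b i
          ≡⟨ cong (λ n → b * X ^ n * thetaPower b i) i+j≡s ⟩
        b * X ^ s * thetaPower b i ∎)

    jacobi-triple : ∀ a b → a * b ≈ X → ∀ r s →
      pochhammer a r * pochhammer b s ≈ antidiagonal (r ℕ.+ s) (λ i j → gaussian i j * thetaTerm a b (i ⊖ s))
    jacobi-triple a b ab≈X zero s = begin
      1# * pochhammer b s
        ≈⟨ ≈-trans (*-identityˡ _) (pochhammer-expansion b s) ⟩
      antidiagonal s (λ i j → gaussian i j * thetaPower b i)
        -- The diagonal is reversed because the j-th power of b belongs to the index i - s = -j.
        ≈⟨ antidiagonal-swap s _ ⟩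
      antidiagonal s (λ i j → gaussian j i * thetaPower b j)
        ≈⟨ antidiagonal-cong s (λ i j i+j≡s → *-cong (gaussian-sym j i) (negative i j s i+j≡s)) ⟩
      antidiagonal s (λ i j → gaussian i j * thetaTerm a b (i ⊖ s)) ∎
      where
      negative : ∀ i j s → i ℕ.+ j ≡ s → thetaPower b j ≈ thetaTerm a b (i ⊖ s)
      negative zero    zero    _ refl = ≈-refl
      negative zero    (suc j) _ refl = ≈-refl
      negative (suc i) j       _ refl = ≈-trans (negative i j _ refl)
        (reflexive (cong (thetaTerm a b) (sym (ℤ.[1+m]⊖[1+n]≡m⊖n i (i ℕ.+ j)))))
    jacobi-triple a b ab≈X (suc r) s = begin
      pochhammer a r * (1# + a * X ^ r) * pochhammer b s
        ≈⟨ solve 3 (λ x y z → x :* y :* z := x :* z :* y) ≈-refl _ _ _ ⟩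
      pochhammer a r * pochhammer b s * (1# + a * X ^ r)
        ≈⟨ *-congʳ (jacobi-triple a b ab≈X r s) ⟩
      antidiagonal (r ℕ.+ s) (λ i j → gaussian i j * thetaTerm a b (i ⊖ s)) * (1# + a * X ^ r)
        ≈⟨ pochhammer-step a (r ℕ.+ s) r (λ i → thetaTerm a b (i ⊖ s))
             (λ i j eq → thetaTerm-step a b ab≈X i j r s eq) ⟩
      antidiagonal (suc r ℕ.+ s) (λ i j → gaussian i j * thetaTerm a b (i ⊖ s)) ∎

-- Power series modulo q^N

Series : Set
Series = ℕ → ℤ

infixl 7 _·_
infixl 6 _⊕_

-- By recursion rather than pointwise, so that unification can recover f and g from f ⊕ g.
_⊕_ : Series → Series → Series
(f ⊕ g) zero    = f 0 ℤ.+ g 0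
(f ⊕ g) (suc n) = (f ∘ suc ⊕ g ∘ suc) n

_·_ : Series → Series → Series
(f · g) zero    = f 0 ℤ.* g 0
(f · g) (suc n) = f 0 ℤ.* g (suc n) ℤ.+ (f ∘ suc · g) n

𝟎 : Series
𝟎 _ = 0ℤ

monomial : ℤ → ℕ → Series
monomial c zero    zero    = c
monomial c zero    (suc n) = 0ℤ
monomial c (suc e) zero    = 0ℤ
monomial c (suc e) (suc n) = monomial c e n

𝟏 : Series
𝟏 = monomial 1ℤ 0

⊕-coefficient : ∀ f g n → (f ⊕ g) n ≡ f n ℤ.+ g n
⊕-coefficient f g zero    = refl
⊕-coefficient f g (suc n) = ⊕-coefficient (f ∘ suc) (g ∘ suc) n

·-congₙ : ∀ n {f f′ g g′} → (∀ i → i ≤ n → f i ≡ f′ i) → (∀ i → i ≤ n → g i ≡ g′ i) →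
          (f · g) n ≡ (f′ · g′) n
·-congₙ zero    p q = cong₂ ℤ._*_ (p 0 z≤n) (q 0 z≤n)
·-congₙ (suc n) p q = cong₂ ℤ._+_ (cong₂ ℤ._*_ (p 0 z≤n) (q (suc n) ℕ.≤-refl))
  (·-congₙ n (λ i i≤n → p (suc i) (s≤s i≤n)) (λ i i≤n → q i (ℕ.m≤n⇒m≤1+n i≤n)))

·-zeroˡ : ∀ f n → (𝟎 · f) n ≡ 0ℤ
·-zeroˡ f zero    = refl
·-zeroˡ f (suc n) = trans (ℤ.+-identityˡ _) (·-zeroˡ f n)

constant-· : ∀ c f n → (monomial c 0 · f) n ≡ c ℤ.* f n
constant-· c f zero    = refl
constant-· c f (suc n) = trans (cong (ℤ._+_ (c ℤ.* f (suc n))) (·-zeroˡ f n)) (ℤ.+-identityʳ _)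

·-identityˡ : ∀ f n → (𝟏 · f) n ≡ f n
·-identityˡ f n = trans (constant-· 1ℤ f n) (ℤ.*-identityˡ (f n))

·-distribʳ : ∀ f g h n → ((g ⊕ h) · f) n ≡ (g · f) n ℤ.+ (h · f) n
·-distribʳ f g h zero    = ℤ.*-distribʳ-+ (f 0) (g 0) (h 0)
·-distribʳ f g h (suc n) = trans
  (cong (ℤ._+_ ((g 0 ℤ.+ h 0) ℤ.* f (suc n))) (·-distribʳ f (g ∘ suc) (h ∘ suc) n))
  (lemma (g 0) (h 0) (f (suc n)) ((g ∘ suc · f) n) ((h ∘ suc · f) n))
  where
  lemma : ∀ a b c x y → (a ℤ.+ b) ℤ.* c ℤ.+ (x ℤ.+ y) ≡ (a ℤ.* c ℤ.+ x) ℤ.+ (b ℤ.* c ℤ.+ y)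
  lemma = ℤ-Solver.solve-∀

·-last : ∀ f g n → (f · g) (suc n) ≡ (f · g ∘ suc) n ℤ.+ f (suc n) ℤ.* g 0
·-last f g zero    = refl
·-last f g (suc n) = trans (cong (ℤ._+_ (f 0 ℤ.* g (suc (suc n)))) (·-last (f ∘ suc) g n))
  (sym (ℤ.+-assoc (f 0 ℤ.* g (suc (suc n))) _ _))

·-comm : ∀ f g n → (f · g) n ≡ (g · f) n
·-comm f g zero    = ℤ.*-comm (f 0) (g 0)
·-comm f g (suc n) = trans (·-last f g n)
  (trans (cong₂ ℤ._+_ (·-comm f (g ∘ suc) n) (ℤ.*-comm (f (suc n)) (g 0))) (ℤ.+-comm _ (g 0 ℤ.* f (suc n))))

·-scaleˡ : ∀ c f g n → ((λ i → c ℤ.* f i) · g) n ≡ c ℤ.* (f · g) n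
·-scaleˡ c f g zero    = ℤ.*-assoc c (f 0) (g 0)
·-scaleˡ c f g (suc n) = trans (cong₂ ℤ._+_ (ℤ.*-assoc c (f 0) (g (suc n))) (·-scaleˡ c (f ∘ suc) g n))
  (sym (ℤ.*-distribˡ-+ c (f 0 ℤ.* g (suc n)) ((f ∘ suc · g) n)))

·-assoc : ∀ f g h n → ((f · g) · h) n ≡ (f · (g · h)) n
·-assoc f g h zero    = ℤ.*-assoc (f 0) (g 0) (h 0)
·-assoc f g h (suc n) = begin
  f 0 ℤ.* g 0 ℤ.* h (suc n) ℤ.+ ((λ i → f 0 ℤ.* g (suc i) ℤ.+ (f ∘ suc · g) i) · h) n
    ≡⟨ cong (ℤ._+_ (f 0 ℤ.* g 0 ℤ.* h (suc n))) (trans (·-congₙ n (λ i _ → sym (⊕-coefficient (λ i → f 0 ℤ.* g (suc i)) (f ∘ suc · g) i)) (λ _ _ → refl)) (trans (·-distribʳ h (λ i → f 0 ℤ.* g (suc i)) (f ∘ suc · g) n)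
         (cong₂ ℤ._+_ (·-scaleˡ (f 0) (g ∘ suc) h n) (·-assoc (f ∘ suc) g h n)))) ⟩
  f 0 ℤ.* g 0 ℤ.* h (suc n) ℤ.+ (f 0 ℤ.* (g ∘ suc · h) n ℤ.+ (f ∘ suc · (g · h)) n)
    ≡⟨ lemma (f 0) (g 0) (h (suc n)) ((g ∘ suc · h) n) ((f ∘ suc · (g · h)) n) ⟩
  f 0 ℤ.* (g 0 ℤ.* h (suc n) ℤ.+ (g ∘ suc · h) n) ℤ.+ (f ∘ suc · (g · h)) n ∎
  where
  open ≡-Reasoning
  lemma : ∀ a b c x y → a ℤ.* b ℤ.* c ℤ.+ (a ℤ.* x ℤ.+ y) ≡ a ℤ.* (b ℤ.* c ℤ.+ x) ℤ.+ y
  lemma = ℤ-Solver.solve-∀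

infix 4 _≈[_]_

record _≈[_]_ (f : Series) (N : ℕ) (g : Series) : Set where
  constructor agree
  field coefficient : ∀ n → n < N → f n ≡ g n
open _≈[_]_

exact : ∀ {N f g} → (∀ n → f n ≡ g n) → f ≈[ N ] g
exact eq = agree λ n _ → eq n

⊕-assoc : ∀ f g h n → ((f ⊕ g) ⊕ h) n ≡ (f ⊕ (g ⊕ h)) n
⊕-assoc f g h zero    = ℤ.+-assoc (f 0) (g 0) (h 0)
⊕-assoc f g h (suc n) = ⊕-assoc (f ∘ suc) (g ∘ suc) (h ∘ suc) n

⊕-comm : ∀ f g n → (f ⊕ g) n ≡ (g ⊕ f) n
⊕-comm f g zero    = ℤ.+-comm (f 0) (g 0)
⊕-comm f g (suc n) = ⊕-comm (f ∘ suc) (g ∘ suc) n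

⊕-identityˡ : ∀ f n → (𝟎 ⊕ f) n ≡ f n
⊕-identityˡ f n = trans (⊕-coefficient 𝟎 f n) (ℤ.+-identityˡ (f n))

module _ (_~_ : Rel Series 0ℓ) (~-isEquivalence : IsEquivalence _~_)
         (pointwise : ∀ {f g} → (∀ n → f n ≡ g n) → f ~ g)
         (⊕-cong : Congruent₂ _~_ _⊕_) (·-cong : Congruent₂ _~_ _·_) where

  -- The ring laws hold coefficient by coefficient, so one proof serves exact equality and every
  -- congruence modulo q^N.
  seriesModulo : CommutativeSemiring 0ℓ 0ℓ
  seriesModulo = record
    { Carrier = Series ; _≈_ = _~_ ; _+_ = _⊕_ ; _*_ = _·_ ; 0# = 𝟎 ; 1# = 𝟏
    ; isCommutativeSemiring = isCommutativeSemiringˡ record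
      { +-isCommutativeMonoid = record
        { isMonoid = record
          { isSemigroup = record
            { isMagma = record { isEquivalence = ~-isEquivalence ; ∙-cong = ⊕-cong }
            ; assoc = λ f g h → pointwise (⊕-assoc f g h) }
          ; identity = (λ f → pointwise (⊕-identityˡ f)) , (λ f → pointwise λ n → trans (⊕-comm f 𝟎 n) (⊕-identityˡ f n)) }
        ; comm = λ f g → pointwise (⊕-comm f g) }
      ; *-isCommutativeMonoid = record
        { isMonoid = record
          { isSemigroup = record
            { isMagma = record { isEquivalence = ~-isEquivalence ; ∙-cong = ·-cong }
            ; assoc = λ f g h → pointwise (·-assoc f g h) }
          ; identity = (λ f → pointwise (·-identityˡ f))
                     , (λ f → pointwise λ n → trans (·-comm f 𝟏 n) (·-identityˡ f n)) }
        ; comm = λ f g → pointwise (·-comm f g) }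
      ; distribʳ = λ f g h → pointwise λ n → trans (·-distribʳ f g h n) (sym (⊕-coefficient (g · f) (h · f) n))
      ; zeroˡ = λ f → pointwise (·-zeroˡ f) } }

≈[]-isEquivalence : ∀ N → IsEquivalence (_≈[ N ]_)
≈[]-isEquivalence N = record
  { refl = exact λ _ → refl
  ; sym = λ p → agree λ n n<N → sym (coefficient p n n<N)
  ; trans = λ p q → agree λ n n<N → trans (coefficient p n n<N) (coefficient q n n<N) }

⊕-cong : ∀ {N} → Congruent₂ (_≈[ N ]_) _⊕_
⊕-cong {_} {f} {g} {h} {k} p q = agree λ n n<N → trans (⊕-coefficient f h n)
  (trans (cong₂ ℤ._+_ (coefficient p n n<N) (coefficient q n n<N)) (sym (⊕-coefficient g k n)))

·-cong : ∀ {N} → Congruent₂ (_≈[ N ]_) _·_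
·-cong p q = agree λ n n<N →
  ·-congₙ n (λ i i≤n → coefficient p i (ℕ.≤-<-trans i≤n n<N))
            (λ i i≤n → coefficient q i (ℕ.≤-<-trans i≤n n<N))

truncatedSeries : ℕ → CommutativeSemiring 0ℓ 0ℓ
truncatedSeries N = seriesModulo (_≈[ N ]_) (≈[]-isEquivalence N) exact ⊕-cong ·-cong

-- The finite triple product is exact. Stated here, its ingredients do not depend on N, and
-- congruences of different precision speak of the same series.
powerSeries : CommutativeSemiring 0ℓ 0ℓ
powerSeries = seriesModulo (λ f g → ∀ N → f ≈[ N ] g)
  (record
    { refl = λ N → IsEquivalence.refl (≈[]-isEquivalence N)
    ; sym = λ p N → IsEquivalence.sym (≈[]-isEquivalence N) (p N)
    ; trans = λ p q N → IsEquivalence.trans (≈[]-isEquivalence N) (p N) (q N) })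
  (λ eq N → exact eq) (λ p q N → ⊕-cong (p N) (q N)) (λ p q N → ·-cong (p N) (q N))

weaken : ∀ {M N f g} → N ≤ M → f ≈[ M ] g → f ≈[ N ] g
weaken N≤M p = agree λ n n<N → coefficient p n (ℕ.<-≤-trans n<N N≤M)

monomial-coefficient : ∀ c e → monomial c e e ≡ c
monomial-coefficient c zero    = refl
monomial-coefficient c (suc e) = monomial-coefficient c e

monomial-≢ : ∀ c e {n} → n ≢ e → monomial c e n ≡ 0ℤ
monomial-≢ c zero    {zero}  n≢e = contradiction refl n≢e
monomial-≢ c zero    {suc n} n≢e = refl
monomial-≢ c (suc e) {zero}  n≢e = refl
monomial-≢ c (suc e) {suc n} n≢e = monomial-≢ c e (n≢e ∘ cong suc)

shift-·-zero : ∀ c e f → (monomial c (suc e) · f) 0 ≡ 0ℤ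
shift-·-zero c e f = ℤ.*-zeroˡ (f 0)

shift-·-suc : ∀ c e f n → (monomial c (suc e) · f) (suc n) ≡ (monomial c e · f) n
shift-·-suc c e f n = ℤ.+-identityˡ ((monomial c e · f) n)

monomial-·-< : ∀ c e f {n} → n < e → (monomial c e · f) n ≡ 0ℤ
monomial-·-< c (suc e) f {zero}  _         = shift-·-zero c e f
monomial-·-< c (suc e) f {suc n} (s≤s n<e) = trans (shift-·-suc c e f n) (monomial-·-< c e f n<e)

monomial-·-+ : ∀ c e f n → (monomial c e · f) (e ℕ.+ n) ≡ c ℤ.* f n
monomial-·-+ c zero    f n = constant-· c f n
monomial-·-+ c (suc e) f n = trans (shift-·-suc c e f (e ℕ.+ n)) (monomial-·-+ c e f n)

monomial-·-monomial : ∀ c e d e′ n → (monomial c e · monomial d e′) n ≡ monomial (c ℤ.* d) (e ℕ.+ e′) n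
monomial-·-monomial c zero    d e′ n = trans (constant-· c _ n) (scale e′ n)
  where
  scale : ∀ e n → c ℤ.* monomial d e n ≡ monomial (c ℤ.* d) e n
  scale zero    zero    = refl
  scale zero    (suc n) = ℤ.*-zeroʳ c
  scale (suc e) zero    = ℤ.*-zeroʳ c
  scale (suc e) (suc n) = scale e n
monomial-·-monomial c (suc e) d e′ zero    = shift-·-zero c e (monomial d e′)
monomial-·-monomial c (suc e) d e′ (suc n) =
  trans (shift-·-suc c e _ n) (monomial-·-monomial c e d e′ n)

-- A factor q^e gains e coefficients of precision. This compensates for the poor precision of the
-- outer Gaussian coefficients in the triple product.
monomial-·-cong : ∀ c e {P f g} → f ≈[ P ] g → monomial c e · f ≈[ e ℕ.+ P ] monomial c e · g
monomial-·-cong c zero    p = ·-cong (exact λ _ → refl) p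
monomial-·-cong c (suc e) {f = f} {g} p = agree λ
  { zero    _         → trans (shift-·-zero c e f) (sym (shift-·-zero c e g))
  ; (suc n) (s≤s n<N) → trans (shift-·-suc c e f n)
      (trans (coefficient (monomial-·-cong c e p) n n<N) (sym (shift-·-suc c e g n))) }

1+monomial≈1 : ∀ c {e N} → N ≤ e → 𝟏 ⊕ monomial c e ≈[ N ] 𝟏
1+monomial≈1 c {e} N≤e = agree λ n n<N →
  trans (⊕-coefficient 𝟏 (monomial c e) n) (trans (cong (ℤ._+_ (𝟏 n)) (monomial-≢ c e (ℕ.<⇒≢ (ℕ.<-≤-trans n<N N≤e)))) (ℤ.+-identityʳ _))

-- With constant coefficient 1, the coefficient of q^n in f · g is g n plus terms in earlier
-- coefficients of g, so these are recovered in increasing order.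
·-cancelˡ : ∀ {N f g h} → f 0 ≡ 1ℤ → f · g ≈[ N ] f · h → g ≈[ N ] h
·-cancelˡ {N} {f} {g} {h} f₀≡1 eq = agree λ n n<N → go n n<N n ℕ.≤-refl
  where
  go : ∀ n → n < N → ∀ i → i ≤ n → g i ≡ h i
  top : ∀ n → n < N → g n ≡ h n
  go n n<N i i≤n with ℕ.m≤n⇒m<n∨m≡n i≤n
  go (suc n) n<N i i≤n | inj₁ (s≤s i≤n′) = go n (ℕ.<⇒≤ n<N) i i≤n′
  go n n<N i i≤n | inj₂ refl = top n n<N
  unit : ∀ k → f 0 ℤ.* k ≡ k
  unit k = trans (cong (ℤ._* k) f₀≡1) (ℤ.*-identityˡ k)
  top zero    n<N = trans (sym (unit (g 0))) (trans (coefficient eq 0 n<N) (unit (h 0)))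
  top (suc n) n<N = trans (sym (unit (g (suc n)))) (trans
    (∙-cancelʳ ((f ∘ suc · g) n) (f 0 ℤ.* g (suc n)) (f 0 ℤ.* h (suc n)) (trans (coefficient eq (suc n) n<N)
      (cong (ℤ._+_ (f 0 ℤ.* h (suc n))) (·-congₙ n (λ _ _ → refl)
        (λ i i≤n → sym (go n (ℕ.<⇒≤ n<N) i i≤n)))))) (unit (h (suc n))))

-- The triple product for X = q^25, modulo q^N

module _ where
  open Exp (CommutativeSemiring.semiring powerSeries) using (_^_)
  open JacobiTriple powerSeries using
    (antidiagonal; antidiagonal-*; pochhammer; gaussian; gaussian-factorial; thetaPower; thetaTerm; jacobi-triple)

  X : Series
  X = monomial 1ℤ 25

  X-^ : ∀ j n → (X ^ j) n ≡ monomial 1ℤ (j ℕ.* 25) n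
  X-^ zero    n = refl
  X-^ (suc j) n = trans (·-congₙ n (λ _ _ → refl) (λ i _ → X-^ j i)) (monomial-·-monomial 1ℤ 25 1ℤ (j ℕ.* 25) n)

  monomial-·-X-^ : ∀ c e j n → (monomial c e · X ^ j) n ≡ monomial c (e ℕ.+ j ℕ.* 25) n
  monomial-·-X-^ c e j n = trans (·-congₙ n (λ _ _ → refl) (λ i _ → X-^ j i))
    (trans (monomial-·-monomial c e 1ℤ (j ℕ.* 25) n) (cong (λ c → monomial c (e ℕ.+ j ℕ.* 25) n) (ℤ.*-identityʳ c)))

  -- Kept as a product, to have the shape ε * X of `gaussian-factorial`.
  -X : Series
  -X = monomial -1ℤ 0 · X

  qFactorial : ℕ → Series
  qFactorial = pochhammer X -X

  qFactorial-limit : ∀ {L} k → qFactorial (k ℕ.+ L) ≈[ suc L ] qFactorial L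
  qFactorial-limit {L} zero    = CommutativeSemiring.refl (truncatedSeries _)
  qFactorial-limit {L} (suc k) = begin
    qFactorial (k ℕ.+ L) · (𝟏 ⊕ -X · X ^ (k ℕ.+ L))
      ≈⟨ *-cong (qFactorial-limit k) (+-congˡ (exact λ n →
           trans (·-congₙ n (λ i _ → monomial-·-monomial -1ℤ 0 1ℤ 25 i) (λ _ _ → refl))
                 (monomial-·-X-^ -1ℤ 25 (k ℕ.+ L) n))) ⟩
    qFactorial L · (𝟏 ⊕ monomial -1ℤ (25 ℕ.+ (k ℕ.+ L) ℕ.* 25))
      ≈⟨ *-congˡ (1+monomial≈1 -1ℤ (ℕ.+-mono-≤ {1} (s≤s z≤n) (ℕ.≤-trans (ℕ.m≤n+m L k) (ℕ.m≤m*n (k ℕ.+ L) 25)))) ⟩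
    qFactorial L · 𝟏
      ≈⟨ *-identityʳ _ ⟩
    qFactorial L ∎
    where
    open CommutativeSemiring (truncatedSeries (suc L)) renaming (refl to ≈-refl; sym to ≈-sym; trans to ≈-trans)
    open SetoidReasoning setoid

  qFactorial-limit-≤ : ∀ {L M} → L ≤ M → qFactorial M ≈[ suc L ] qFactorial L
  qFactorial-limit-≤ {L} {M} L≤M =
    subst (λ m → qFactorial m ≈[ suc L ] qFactorial L) (ℕ.m∸n+n≡m L≤M) (qFactorial-limit (M ∸ L))

  qFactorial-constant : ∀ n → qFactorial n 0 ≡ 1ℤ
  qFactorial-constant zero    = refl
  qFactorial-constant (suc n) =
    cong (ℤ._* 1ℤ) (qFactorial-constant n)

  -- Gaussian coefficients tend to the inverse of the infinite q-factorial. No inverse is formed: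
  -- after multiplication by one more `qFactorial L`, only q-factorials remain, and all of them
  -- agree with `qFactorial L` to this precision.
  gaussian-limit : ∀ {L i j M} → L ≤ i → L ≤ j → L ≤ M → qFactorial M · gaussian X i j ≈[ suc L ] 𝟏
  gaussian-limit {L} {i} {j} {M} L≤i L≤j L≤M = ·-cancelˡ (qFactorial-constant L) (begin
    φ L · (φ M · g)       ≈⟨ *-congˡ (*-congʳ (qFactorial-limit-≤ L≤M)) ⟩
    φ L · (φ L · g)       ≈⟨ solve 2 (λ a g → a :* (a :* g) := g :* (a :* a)) ≈-refl (φ L) g ⟩
    g · (φ L · φ L)       ≈⟨ *-congˡ (*-cong (qFactorial-limit-≤ L≤i) (qFactorial-limit-≤ L≤j)) ⟨
    g · (φ i · φ j)       ≈⟨ gaussian-factorial X {monomial -1ℤ 0} -1+1 i j (suc L) ⟩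
    φ (i ℕ.+ j)           ≈⟨ qFactorial-limit-≤ (ℕ.≤-trans L≤i (ℕ.m≤m+n i j)) ⟩
    φ L                   ≈⟨ *-identityʳ _ ⟨
    φ L · 𝟏               ∎)
    where
    open CommutativeSemiring (truncatedSeries (suc L)) renaming (refl to ≈-refl; sym to ≈-sym; trans to ≈-trans)
    open SetoidReasoning setoid
    -1+1 : ∀ N → 𝟏 ⊕ monomial -1ℤ 0 ≈[ N ] 𝟎
    -1+1 N = exact λ { zero → refl ; (suc n) → ⊕-coefficient 𝟎 𝟎 n }
    open SemiringSolver (truncatedSeries (suc L)) using (solve; _:=_; _:*_)
    φ = qFactorial
    g = gaussian X i j

  -- In closed form α j + 25 j (j - 1) / 2.
  powerExponent : ℕ → ℕ → ℕ
  powerExponent α zero    = 0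
  powerExponent α (suc j) = α ℕ.+ j ℕ.* 25 ℕ.+ powerExponent α j

  exponent : ℕ → ℕ → ℤ → ℕ
  exponent α β (+ j)    = powerExponent α j
  exponent α β -[1+ j ] = powerExponent β (suc j)

  thetaMonomial : ℤ → ℕ → ℕ → ℤ → Series
  thetaMonomial ε α β k = monomial (ε ℤ.^ ∣ k ∣) (exponent α β k)

  thetaPower-monomial : ∀ ε α j n → thetaPower X (monomial ε α) j n ≡ monomial (ε ℤ.^ j) (powerExponent α j) n
  thetaPower-monomial ε α zero    n = refl
  thetaPower-monomial ε α (suc j) n = trans
    (·-congₙ n (λ i _ → monomial-·-X-^ ε α j i) (λ i _ → thetaPower-monomial ε α j i))
    (monomial-·-monomial ε (α ℕ.+ j ℕ.* 25) (ε ℤ.^ j) (powerExponent α j) n)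

  thetaTerm-monomial : ∀ ε α β k n → thetaTerm X (monomial ε α) (monomial ε β) k n ≡ thetaMonomial ε α β k n
  thetaTerm-monomial ε α β (+ j)    n = thetaPower-monomial ε α j n
  thetaTerm-monomial ε α β -[1+ j ] n = thetaPower-monomial ε β (suc j) n

  powerExponent-≥ : ∀ α j → j ≤ powerExponent (suc α) j
  powerExponent-≥ α zero    = z≤n
  powerExponent-≥ α (suc j) = ℕ.+-mono-≤ {1} (s≤s z≤n) (powerExponent-≥ α j)

  exponent-≥ : ∀ α β k → ∣ k ∣ ≤ exponent (suc α) (suc β) k
  exponent-≥ α β (+ j)    = powerExponent-≥ α j
  exponent-≥ α β -[1+ j ] = powerExponent-≥ β (suc j)

  interval : ℕ → List ℤ
  interval M = applyUpTo (_⊖ M) (suc (M ℕ.+ M))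

  thetaProduct : ℤ → ℕ → ℕ → ℕ → Series
  thetaProduct ε α β M = pochhammer X (monomial ε α) M · pochhammer X (monomial ε β) M

  module _ (N : ℕ) where
    open CommutativeSemiring (truncatedSeries N) renaming (refl to ≈-refl; sym to ≈-sym; trans to ≈-trans)
    open SetoidReasoning setoid
    open BigSums (truncatedSeries N) using (∑)

    antidiagonal-∑ : ∀ {A : Set} (f : A → Series) g n →
      antidiagonal n (λ i _ → f (g i)) ≈ ∑ (applyUpTo g (suc n)) f
    antidiagonal-∑ f g zero    = ≈-sym (+-identityʳ _)
    antidiagonal-∑ f g (suc n) = +-congˡ (antidiagonal-∑ f (g ∘ suc) n)

    antidiagonal-congₜ : ∀ n {F G} → (∀ i j → i ℕ.+ j ≡ n → F i j ≈ G i j) → antidiagonal n F ≈ antidiagonal n G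
    antidiagonal-congₜ zero    eq = eq 0 0 refl
    antidiagonal-congₜ (suc n) eq =
      +-cong (eq 0 (suc n) refl) (antidiagonal-congₜ n (λ i j i+j≡n → eq (suc i) j (cong suc i+j≡n)))

    -- The q-factorial turns each Gaussian coefficient of the finite triple product into 1, up to an
    -- error that q^N absorbs: the coefficient is precise near the middle of the diagonal, and far
    -- from it the exponent of the theta term is large.
    thetaProduct-∑ : ∀ ε → ε ℤ.* ε ≡ 1ℤ → ∀ α β → suc α ℕ.+ suc β ≡ 25 → ∀ M → N ≤ M →
      qFactorial M · thetaProduct ε (suc α) (suc β) M ≈ ∑ (interval M) (thetaMonomial ε (suc α) (suc β))
    thetaProduct-∑ ε ε²≡1 α β α+β≡25 M N≤M = begin
      qFactorial M · thetaProduct ε (suc α) (suc β) M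
        ≈⟨ *-congˡ (jacobi-triple X (monomial ε (suc α)) (monomial ε (suc β)) ab≈X M M N) ⟩
      qFactorial M · antidiagonal (M ℕ.+ M) (λ i j → gaussian X i j · t (i ⊖ M))
        ≈⟨ antidiagonal-* (M ℕ.+ M) (qFactorial M) _ N ⟩
      antidiagonal (M ℕ.+ M) (λ i j → qFactorial M · (gaussian X i j · t (i ⊖ M)))
        ≈⟨ antidiagonal-congₜ (M ℕ.+ M) (λ i j → term i j) ⟩
      antidiagonal (M ℕ.+ M) (λ i _ → thetaMonomial ε (suc α) (suc β) (i ⊖ M))
        ≈⟨ antidiagonal-∑ (thetaMonomial ε (suc α) (suc β)) (_⊖ M) (M ℕ.+ M) ⟩
      ∑ (interval M) (thetaMonomial ε (suc α) (suc β)) ∎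
      where
      t = thetaTerm X (monomial ε (suc α)) (monomial ε (suc β))
      ab≈X : ∀ N → monomial ε (suc α) · monomial ε (suc β) ≈[ N ] X
      ab≈X N = exact λ n → trans (monomial-·-monomial ε (suc α) ε (suc β) n) (cong₂ (λ c e → monomial c e n) ε²≡1 α+β≡25)

      near : ∀ L i j k → L ≤ i → L ≤ j → L ≤ M → M ≤ ∣ k ∣ ℕ.+ L →
             qFactorial M · (gaussian X i j · t k) ≈ thetaMonomial ε (suc α) (suc β) k
      near L i j k L≤i L≤j L≤M M≤k+L = begin
        qFactorial M · (gaussian X i j · t k)
          ≈⟨ *-congˡ (*-congˡ (exact (thetaTerm-monomial ε (suc α) (suc β) k))) ⟩
        qFactorial M · (gaussian X i j · m)
          ≈⟨ *-assoc _ _ _ ⟨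
        (qFactorial M · gaussian X i j) · m
          ≈⟨ *-comm _ _ ⟩
        m · (qFactorial M · gaussian X i j)
          -- `gaussian-limit` is valid modulo q^(L + 1), and the monomial adds at least ∣ k ∣;
          -- together this exceeds M, hence N.
          ≈⟨ weaken (ℕ.≤-trans N≤M (ℕ.≤-trans M≤k+L (ℕ.+-mono-≤ (exponent-≥ α β k) (ℕ.n≤1+n L))))
               (monomial-·-cong _ _ (gaussian-limit L≤i L≤j L≤M)) ⟩
        m · 𝟏
          ≈⟨ *-identityʳ _ ⟩
        m ∎
        where m = thetaMonomial ε (suc α) (suc β) k

      term : ∀ i j → i ℕ.+ j ≡ M ℕ.+ M →
             qFactorial M · (gaussian X i j · t (i ⊖ M)) ≈ thetaMonomial ε (suc α) (suc β) (i ⊖ M)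
      -- L is the smaller of i and j; since i + j = 2 M, it satisfies ∣ i - M ∣ + L = M exactly.
      term i j i+j≡2M with ℕ.≤-total i M
      ... | inj₁ i≤M = near i i j (i ⊖ M) ℕ.≤-refl
        (ℕ.≤-trans i≤M (ℕ.+-cancelˡ-≤ M M j (ℕ.≤-trans (ℕ.≤-reflexive (sym i+j≡2M)) (ℕ.+-monoˡ-≤ j i≤M))))
        i≤M
        (ℕ.≤-reflexive (sym (trans (cong (ℕ._+ i) (ℤ.∣⊖∣-≤ i≤M)) (ℕ.m∸n+n≡m i≤M))))
      ... | inj₂ M≤i = near j i j (i ⊖ M) (ℕ.≤-trans j≤M M≤i) ℕ.≤-refl j≤M
        (ℕ.≤-reflexive (sym (trans (cong (λ k → ∣ k ∣ ℕ.+ j) (ℤ.⊖-≥ M≤i))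
          (trans (sym (ℕ.+-∸-comm j M≤i)) (trans (cong (_∸ M) i+j≡2M) (ℕ.m+n∸n≡m M M))))))
        where
        j≤M : j ≤ M
        j≤M = ℕ.+-cancelˡ-≤ M j M (ℕ.≤-trans (ℕ.+-monoˡ-≤ j M≤i) (ℕ.≤-reflexive i+j≡2M))

-- Lattice points

module _ where
  open import Data.Integer using (-_; _+_; _*_; _-_; _^_)
  open ℤ-Solver using (solve-∀)

  module _ {A B : Set} {P : A → Set} {Q : B → Set} (P? : Decidable P) (Q? : Decidable Q) where

    -- The maps need to be inverse only on the points counted, and need not carry xs into ys: each
    -- list contains all the points satisfying its predicate.
    length-filter-↔ : ∀ {xs ys} → Unique xs → Unique ys →
      (∀ {a} → P a → a ∈ xs) → (∀ {b} → Q b → b ∈ ys) → (φ : A → B) (ψ : B → A) →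
      (∀ {a} → P a → Q (φ a)) → (∀ {b} → Q b → P (ψ b)) →
      (∀ {a} → P a → ψ (φ a) ≡ a) → (∀ {b} → Q b → φ (ψ b) ≡ b) →
      length (filter P? xs) ≡ length (filter Q? ys)
    length-filter-↔ {xs} {ys} xs! ys! P⊆xs Q⊆ys φ ψ P⇒Q Q⇒P ψφ φψ = trans
      (sym (length-map φ (filter P? xs)))
      (↭-length (∼bag⇒↭ (unique∧set⇒bag image! (Unique.filter⁺ Q? ys!) (mk⇔ to from))))
      where
      image! : Unique (map φ (filter P? xs))
      -- Injectivity of φ on the filtered list: mapping ψ over the image gives back a list without
      -- repetitions.
      image! = Unique.map⁻ (subst Unique (sym (trans (sym (map-∘ {g = ψ} {f = φ} (filter P? xs)))
        (map-id-local (All.map ψφ (all-filter P? xs))))) (Unique.filter⁺ P? xs!))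
      to : ∀ {b} → b ∈ map φ (filter P? xs) → b ∈ filter Q? ys
      to b∈ with ∈-map⁻ φ b∈
      ... | a , a∈ , refl = ∈-filter⁺ Q? (Q⊆ys Qφa) Qφa
        where Qφa = P⇒Q (proj₂ (∈-filter⁻ P? {xs = xs} a∈))
      from : ∀ {b} → b ∈ filter Q? ys → b ∈ map φ (filter P? xs)
      from b∈ = subst (_∈ map φ (filter P? xs)) (φψ Qb)
        (∈-map⁺ φ (∈-filter⁺ P? (P⊆xs (Q⇒P Qb)) (Q⇒P Qb)))
        where Qb = proj₂ (∈-filter⁻ Q? {xs = ys} b∈)

  -- Halves and parities of integers

  ⌊_/2⌋ℤ : ℤ → ℤ
  ⌊ + n      /2⌋ℤ = + ⌊ n /2⌋
  ⌊ -[1+ n ] /2⌋ℤ = -[1+ ⌊ n /2⌋ ]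

  ⌊1+n+n/2⌋ : ∀ n → ⌊ suc (n ℕ.+ n) /2⌋ ≡ n
  ⌊1+n+n/2⌋ n = sym (ℕ.n≡⌈n+n/2⌉ n)

  data Bit : ℤ → Set where
    even : Bit 0ℤ
    odd  : Bit 1ℤ

  ⌊/2⌋-unique : ∀ {π} → Bit π → ∀ t {s} → s ≡ t + t + π → ⌊ s /2⌋ℤ ≡ t
  ⌊/2⌋-unique even (+ n)      refl = cong +_ (trans (cong ⌊_/2⌋ (ℕ.+-identityʳ (n ℕ.+ n))) (sym (ℕ.n≡⌊n+n/2⌋ n)))
  ⌊/2⌋-unique even -[1+ n ]   refl = cong -[1+_] (⌊1+n+n/2⌋ n)
  ⌊/2⌋-unique odd  (+ n)      refl = cong +_ (trans (cong ⌊_/2⌋ (ℕ.+-comm (n ℕ.+ n) 1)) (⌊1+n+n/2⌋ n))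
  ⌊/2⌋-unique odd  -[1+ n ]   refl = cong -[1+_] (sym (ℕ.n≡⌊n+n/2⌋ n))

  -- An equation with the computed half, hence decidable without a search for a witness; the half
  -- itself is the amount t by which the reflection translates.
  HasBit : ℤ → ℤ → Set
  HasBit π s = s ≡ ⌊ s /2⌋ℤ + ⌊ s /2⌋ℤ + π

  hasBit : ∀ {π} → Bit π → ∀ t {s} → s ≡ t + t + π → HasBit π s
  hasBit {π} b t eq = trans eq (cong (λ h → h + h + π) (sym (⌊/2⌋-unique b t eq)))

  bit-suc : ∀ s → HasBit 0ℤ s ⊎ HasBit 1ℤ s → HasBit 0ℤ (1ℤ + s) ⊎ HasBit 1ℤ (1ℤ + s)
  bit-suc s (inj₁ p) = inj₂ (hasBit odd ⌊ s /2⌋ℤ (trans (cong (_+_ 1ℤ) p) (lemma ⌊ s /2⌋ℤ)))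
    where
    lemma : ∀ h → 1ℤ + (h + h + 0ℤ) ≡ h + h + 1ℤ
    lemma = solve-∀
  bit-suc s (inj₂ p) = inj₁ (hasBit even (1ℤ + ⌊ s /2⌋ℤ) (trans (cong (_+_ 1ℤ) p) (lemma ⌊ s /2⌋ℤ)))
    where
    lemma : ∀ h → 1ℤ + (h + h + 1ℤ) ≡ (1ℤ + h) + (1ℤ + h) + 0ℤ
    lemma = solve-∀

  bit-neg : ∀ s → HasBit 0ℤ s ⊎ HasBit 1ℤ s → HasBit 0ℤ (- s) ⊎ HasBit 1ℤ (- s)
  bit-neg s (inj₁ p) = inj₁ (hasBit even (- ⌊ s /2⌋ℤ) (trans (cong -_ p) (lemma ⌊ s /2⌋ℤ)))
    where
    lemma : ∀ h → - (h + h + 0ℤ) ≡ - h + - h + 0ℤ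
    lemma = solve-∀
  bit-neg s (inj₂ p) = inj₂ (hasBit odd (-1ℤ - ⌊ s /2⌋ℤ) (trans (cong -_ p) (lemma ⌊ s /2⌋ℤ)))
    where
    lemma : ∀ h → - (h + h + 1ℤ) ≡ (-1ℤ - h) + (-1ℤ - h) + 1ℤ
    lemma = solve-∀

  bit-ℕ : ∀ n → HasBit 0ℤ (+ n) ⊎ HasBit 1ℤ (+ n)
  bit-ℕ zero    = inj₁ refl
  bit-ℕ (suc n) = bit-suc (+ n) (bit-ℕ n)

  bit : ∀ s → HasBit 0ℤ s ⊎ HasBit 1ℤ s
  bit (+ n)    = bit-ℕ n
  bit -[1+ n ] = bit-neg (+ suc n) (bit-ℕ (suc n))

  bits-exclusive : ∀ s → HasBit 0ℤ s → ¬ HasBit 1ℤ s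
  bits-exclusive s p q = 0≢1 (∙-cancelˡ (h + h) 0ℤ 1ℤ (trans (sym p) q))
    where
    h = ⌊ s /2⌋ℤ
    0≢1 : 0ℤ ≢ 1ℤ
    0≢1 ()

  parity : ℤ → ℤ
  parity s = -1ℤ ^ ∣ s ∣

  square-1^ : ∀ n → -1ℤ ^ n * -1ℤ ^ n ≡ 1ℤ
  square-1^ zero    = refl
  square-1^ (suc n) = trans (lemma (-1ℤ ^ n)) (square-1^ n)
    where
    lemma : ∀ x → -1ℤ * x * (-1ℤ * x) ≡ x * x
    lemma = solve-∀

  -1^n+n : ∀ n → -1ℤ ^ (n ℕ.+ n) ≡ 1ℤ
  -1^n+n n = trans (ℤ.^-distribˡ-+-* -1ℤ n n) (square-1^ n)

  parity-even : ∀ t {s} → s ≡ t + t + 0ℤ → parity s ≡ 1ℤ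
  parity-even (+ n)    refl = trans (cong (-1ℤ ^_) (ℕ.+-identityʳ (n ℕ.+ n))) (-1^n+n n)
  parity-even -[1+ n ] refl = trans (cong (λ x → -1ℤ * (-1ℤ * x)) (-1^n+n n)) refl

  parity-odd : ∀ t {s} → s ≡ t + t + 1ℤ → parity s ≡ -1ℤ
  parity-odd (+ n)    refl = trans (cong (-1ℤ ^_) (ℕ.+-comm (n ℕ.+ n) 1)) (cong (-1ℤ *_) (-1^n+n n))
  parity-odd -[1+ n ] refl = cong (-1ℤ *_) (-1^n+n n)

  -- Absolute values do not add, so the law of exponents does not apply directly and the four cases
  -- of parity are compared.
  parity-+ : ∀ x y → parity x * parity y ≡ parity (x + y)
  parity-+ x y = cases (bit x) (bit y)
    where
    a = ⌊ x /2⌋ℤ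
    b = ⌊ y /2⌋ℤ
    halves : ∀ a b π ρ → (a + a + π) + (b + b + ρ) ≡ (a + b) + (a + b) + (π + ρ)
    halves = solve-∀
    carry : ∀ c → c + c + (1ℤ + 1ℤ) ≡ (c + 1ℤ) + (c + 1ℤ) + 0ℤ
    carry = solve-∀
    sum : ∀ {π ρ} → HasBit π x → HasBit ρ y → x + y ≡ (a + b) + (a + b) + (π + ρ)
    sum {π} {ρ} p q = trans (cong₂ _+_ p q) (halves a b π ρ)
    cases : HasBit 0ℤ x ⊎ HasBit 1ℤ x → HasBit 0ℤ y ⊎ HasBit 1ℤ y → parity x * parity y ≡ parity (x + y)
    cases (inj₁ p) (inj₁ q) = trans (cong₂ _*_ (parity-even a p) (parity-even b q)) (sym (parity-even (a + b) (sum p q)))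
    cases (inj₁ p) (inj₂ q) = trans (cong₂ _*_ (parity-even a p) (parity-odd b q)) (sym (parity-odd (a + b) (sum p q)))
    cases (inj₂ p) (inj₁ q) = trans (cong₂ _*_ (parity-odd a p) (parity-even b q)) (sym (parity-odd (a + b) (sum p q)))
    cases (inj₂ p) (inj₂ q) = trans (cong₂ _*_ (parity-odd a p) (parity-odd b q))
      (sym (parity-even (a + b + 1ℤ) (trans (sum p q) (carry (a + b)))))

  -- Residues modulo 25 and their quadratic exponents

  record Residue : Set where
    constructor residuePair
    field
      -- Predecessors are stored to make both residues positive, which `exponent-≥` needs to bound ∣
      -- k ∣ by the exponent.
      low⁻ high⁻    : ℕ
      complementary : suc low⁻ ℕ.+ suc high⁻ ≡ 25
    low  = suc low⁻
    high = suc high⁻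

  open Residue

  opposite : Residue → Residue
  opposite (residuePair a b eq) = residuePair b a (trans (ℕ.+-comm (suc b) (suc a)) eq)

  residueExponent : Residue → ℤ → ℕ
  residueExponent r = exponent (low r) (high r)

  -- Completing the square, 200 · residueExponent r k + slope r ² = (50 k + slope r)².
  slope : Residue → ℤ
  slope r = + low r - + high r

  -- Doubling clears the denominator of the quadratic form, and α + β = 25 makes the linear
  -- coefficient α - β, which changes sign with the index; so one formula covers all integers k.
  powerExponent-double : ∀ α β → α ℕ.+ β ≡ 25 → ∀ j →
    + powerExponent α j + + powerExponent α j ≡ + 25 * (+ j * + j) + (+ α - + β) * + j
  powerExponent-double α β eq zero    = sym (trans (ℤ.+-identityˡ _) (ℤ.*-zeroʳ (+ α - + β)))
  powerExponent-double α β eq (suc j) = begin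
    + (α ℕ.+ j ℕ.* 25 ℕ.+ ν) + + (α ℕ.+ j ℕ.* 25 ℕ.+ ν)
      ≡⟨ cong (λ x → x + x) (trans (ℤ.pos-+ (α ℕ.+ j ℕ.* 25) ν)
           (cong (_+ + ν) (trans (ℤ.pos-+ α (j ℕ.* 25)) (cong (_+_ (+ α)) (ℤ.pos-* j 25))))) ⟩
    (+ α + + j * + 25 + + ν) + (+ α + + j * + 25 + + ν)
      ≡⟨ lemma (+ α) (+ j) (+ ν) ⟩
    (+ ν + + ν) + (+ α + + α + + 50 * + j)
      ≡⟨ cong (_+ (+ α + + α + + 50 * + j)) (powerExponent-double α β eq j) ⟩
    (+ 25 * (+ j * + j) + (+ α - + β) * + j) + (+ α + + α + + 50 * + j)
      ≡⟨ lemma′ (+ α) (+ β) (+ j) ⟩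
    + 25 * ((1ℤ + + j) * (1ℤ + + j)) + (+ α - + β) * (1ℤ + + j) + ((+ α + + β) - + 25)
      ≡⟨ cong (λ y → + 25 * ((1ℤ + + j) * (1ℤ + + j)) + (+ α - + β) * (1ℤ + + j) + (y - + 25))
           (trans (sym (ℤ.pos-+ α β)) (cong +_ eq)) ⟩
    + 25 * ((1ℤ + + j) * (1ℤ + + j)) + (+ α - + β) * (1ℤ + + j) + 0ℤ
      ≡⟨ ℤ.+-identityʳ _ ⟩
    + 25 * (+ suc j * + suc j) + (+ α - + β) * + suc j ∎
    where
    open ≡-Reasoning
    ν = powerExponent α j
    lemma : ∀ a j ν → (a + j * + 25 + ν) + (a + j * + 25 + ν) ≡ (ν + ν) + (a + a + + 50 * j)
    lemma = solve-∀
    lemma′ : ∀ a b j → (+ 25 * (j * j) + (a - b) * j) + (a + a + + 50 * j) ≡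
      + 25 * ((1ℤ + j) * (1ℤ + j)) + (a - b) * (1ℤ + j) + ((a + b) - + 25)
    lemma′ = solve-∀

  residueExponent-double : ∀ r k →
    + residueExponent r k + + residueExponent r k ≡ + 25 * (k * k) + slope r * k
  residueExponent-double r (+ j)    = powerExponent-double (low r) (high r) (complementary r) j
  residueExponent-double r -[1+ j ] = trans
    (powerExponent-double (high r) (low r) (trans (ℕ.+-comm (high r) (low r)) (complementary r)) (suc j))
    (lemma (+ low r) (+ high r) (+ suc j))
    where
    lemma : ∀ a b j → + 25 * (j * j) + (b - a) * j ≡ + 25 * (- j * - j) + (a - b) * - j
    lemma = solve-∀

  opposite-exponent : ∀ r k → residueExponent (opposite r) (- k) ≡ residueExponent r k
  opposite-exponent r (+ zero)  = refl
  opposite-exponent r (+ suc j) = refl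
  opposite-exponent r -[1+ j ]  = refl

  Residues : Set
  Residues = Residue × Residue × Residue × Residue

  Point : Set
  Point = ℤ × ℤ × ℤ × ℤ

  total : Point → ℤ
  total (k₁ , k₂ , k₃ , k₄) = k₁ + (k₂ + (k₃ + k₄))

  totalExponent : Residues → Point → ℕ
  totalExponent (r₁ , r₂ , r₃ , r₄) (k₁ , k₂ , k₃ , k₄) =
    residueExponent r₁ k₁ ℕ.+ (residueExponent r₂ k₂ ℕ.+ (residueExponent r₃ k₃ ℕ.+ residueExponent r₄ k₄))

  box : ℕ → List Point
  box M = cartesianProduct (interval M) (cartesianProduct (interval M) (cartesianProduct (interval M) (interval M)))

  interval-unique : ∀ M → Unique (interval M)
  interval-unique M = Unique.applyUpTo⁺₁ (_⊖ M) _ λ {i} {j} i<j _ eq → ℕ.<⇒≢ i<j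
    (ℤ.+-injective (∙-cancelʳ (- + M) (+ i) (+ j) (trans (ℤ.m-n≡m⊖n i M) (trans eq (sym (ℤ.m-n≡m⊖n j M))))))

  ∈-interval : ∀ M k → ∣ k ∣ ≤ M → k ∈ interval M
  ∈-interval M (+ n)    n≤M = subst (_∈ interval M)
    (trans (ℤ.⊖-≥ (ℕ.m≤n+m M n)) (cong +_ (ℕ.m+n∸n≡m n M)))
    (∈-applyUpTo⁺ (_⊖ M) (s≤s (ℕ.+-monoˡ-≤ M n≤M)))
  ∈-interval M -[1+ n ] n<M = subst (_∈ interval M)
    (trans (ℤ.⊖-≤ (ℕ.m∸n≤m M (suc n))) (cong (-_ ∘ +_) (ℕ.m∸[m∸n]≡n n<M)))
    (∈-applyUpTo⁺ (_⊖ M) (s≤s (ℕ.≤-trans (ℕ.m∸n≤m M (suc n)) (ℕ.m≤m+n M M))))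

  box-unique : ∀ M → Unique (box M)
  box-unique M = Unique.cartesianProduct⁺ I! (Unique.cartesianProduct⁺ I! (Unique.cartesianProduct⁺ I! I!))
    where I! = interval-unique M

  ∈-box : ∀ R k M → totalExponent R k ≤ M → k ∈ box M
  ∈-box (r₁ , r₂ , r₃ , r₄) (k₁ , k₂ , k₃ , k₄) M e≤M =
    ∈-cartesianProduct⁺ (∈I r₁ k₁ (ℕ.m+n≤o⇒m≤o _ e≤M)) (∈-cartesianProduct⁺ (∈I r₂ k₂ (ℕ.m+n≤o⇒m≤o _ e₂≤M))
      (∈-cartesianProduct⁺ (∈I r₃ k₃ (ℕ.m+n≤o⇒m≤o _ e₃≤M)) (∈I r₄ k₄ (ℕ.m+n≤o⇒n≤o (residueExponent r₃ k₃) e₃≤M))))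
    where
    ∈I : ∀ r k → residueExponent r k ≤ M → k ∈ interval M
    ∈I r k e≤M = ∈-interval M k (ℕ.≤-trans (exponent-≥ (low⁻ r) (high⁻ r) k) e≤M)
    e₂≤M = ℕ.m+n≤o⇒n≤o (residueExponent r₁ k₁) e≤M
    e₃≤M = ℕ.m+n≤o⇒n≤o (residueExponent r₂ k₂) e₂≤M

  -- Lattice points counted by exponent and parity

  Solution : ℕ → Residues → ℤ → ℕ → Point → Set
  Solution x R π n k = x ℕ.+ totalExponent R k ≡ n × HasBit π (total k)

  solution? : ∀ x R π n → Decidable (Solution x R π n)
  solution? x R π n k = (x ℕ.+ totalExponent R k ℕ.≟ n) ×-dec (total k ℤ.≟ _)

  solutions : ℕ → ℕ → Residues → ℤ → ℕ → ℕ
  solutions M x R π n = length (filter (solution? x R π n) (box M))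

  solution-∈-box : ∀ x R {M π n k} → n ≤ M → Solution x R π n k → k ∈ box M
  solution-∈-box x R {M} {k = k} n≤M (refl , _) = ∈-box R k M (ℕ.m+n≤o⇒n≤o x n≤M)

  oppositeFirst : Residues → Residues
  oppositeFirst (r₁ , r) = opposite r₁ , r

  -- Negating the first coordinate swaps the two residues there and changes the total by an even
  -- number. Conjugation by it turns the reflection in (1, 1, 1, 1) into the one in (-1, 1, 1, 1).
  solutions-oppositeFirst : ∀ {M x R π n} → Bit π → n ≤ M →
    solutions M x (oppositeFirst R) π n ≡ solutions M x R π n
  solutions-oppositeFirst {M} {x} {R} {π} {n} b n≤M =
    length-filter-↔ (solution? x (oppositeFirst R) π n) (solution? x R π n) (box-unique M) (box-unique M)
      (solution-∈-box x (oppositeFirst R) n≤M) (solution-∈-box x R n≤M) negate negate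
      (λ {a} (p , q) → trans (cong (x ℕ.+_) (exponent₁ a)) p , negate-bit a q)
      (λ {a} (p , q) → trans (cong (x ℕ.+_) (exponent₂ a)) p , negate-bit a q)
      (λ {a} _ → involutive a) (λ {a} _ → involutive a)
    where
    negate : Point → Point
    negate (k₁ , k) = - k₁ , k
    involutive : ∀ a → negate (negate a) ≡ a
    involutive (k₁ , k) = cong (_, k) (ℤ.neg-involutive k₁)
    exponent₂ : ∀ a → totalExponent (oppositeFirst R) (negate a) ≡ totalExponent R a
    exponent₂ (k₁ , k) = cong (ℕ._+ _) (opposite-exponent (proj₁ R) k₁)
    exponent₁ : ∀ a → totalExponent R (negate a) ≡ totalExponent (oppositeFirst R) a
    exponent₁ a = trans (sym (exponent₂ (negate a))) (cong (totalExponent (oppositeFirst R)) (involutive a))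
    negate-bit : ∀ a → HasBit π (total a) → HasBit π (total (negate a))
    negate-bit (k₁ , k) q = hasBit b (⌊ s /2⌋ℤ - k₁) (trans (lemma₁ k₁ _) (trans (cong (_- (k₁ + k₁)) q) (lemma₂ k₁ ⌊ s /2⌋ℤ π)))
      where
      s = total (k₁ , k)
      lemma₁ : ∀ a c → - a + c ≡ (a + c) - (a + a)
      lemma₁ = solve-∀
      lemma₂ : ∀ a h p → h + h + p - (a + a) ≡ (h - a) + (h - a) + p
      lemma₂ = solve-∀

  -- The reflection y ↦ y - ½ (Σ y) (1, 1, 1, 1) of the vectors y = 50 k + slope R, where Σ k = 2 t + π,
  -- carries them to the vectors 50 k′ + slope R′ with k′ = k - t + e; then Σ k′ = 2 (f - t) + π′.
  record Reflection (x : ℕ) (R : Residues) (π : ℤ) (x′ : ℕ) (R′ : Residues) (π′ : ℤ) (e : Point) (f : ℤ) : Set where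
    constructor reflection
    private
      u₁ = slope (proj₁ R)
      u₂ = slope (proj₁ (proj₂ R))
      u₃ = slope (proj₁ (proj₂ (proj₂ R)))
      u₄ = slope (proj₂ (proj₂ (proj₂ R)))
      v₁ = slope (proj₁ R′)
      v₂ = slope (proj₁ (proj₂ R′))
      v₃ = slope (proj₁ (proj₂ (proj₂ R′)))
      v₄ = slope (proj₂ (proj₂ (proj₂ R′)))
      e₁ = proj₁ e
      e₂ = proj₁ (proj₂ e)
      e₃ = proj₁ (proj₂ (proj₂ e))
      e₄ = proj₂ (proj₂ (proj₂ e))
      h = ⌊ total (u₁ , u₂ , u₃ , u₄) /2⌋ℤ
      s = + 25 * π + h
    field
      slopes-even : total (u₁ , u₂ , u₃ , u₄) ≡ h + h
      slope₁ : v₁ ≡ u₁ - s - + 50 * e₁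
      slope₂ : v₂ ≡ u₂ - s - + 50 * e₂
      slope₃ : v₃ ≡ u₃ - s - + 50 * e₃
      slope₄ : v₄ ≡ u₄ - s - + 50 * e₄
      bits : π + total e ≡ f + f + π′
      shift : total (v₁ * e₁ + + 25 * (e₁ * e₁) , v₂ * e₂ + + 25 * (e₂ * e₂) ,
                     v₃ * e₃ + + 25 * (e₃ * e₃) , v₄ * e₄ + + 25 * (e₄ * e₄)) - s * π + (+ x′ + + x′) ≡ + x + + x

  translate : Point → Point → Point
  translate (e₁ , e₂ , e₃ , e₄) k@(k₁ , k₂ , k₃ , k₄) = k₁ - t + e₁ , k₂ - t + e₂ , k₃ - t + e₃ , k₄ - t + e₄
    where t = ⌊ total k /2⌋ℤ

  -- One coordinate of the change of variables: the old quadratic term, a cross term that collapses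
  -- once the four coordinates are summed, and a constant accounted for by `shift`.
  coset : ∀ k t e u v s → v ≡ u - s - + 50 * e →
    + 25 * ((k - t + e) * (k - t + e)) + v * (k - t + e) ≡
    (+ 25 * (k * k) + u * k) + (+ 25 * (t * t) - + 50 * (k * t) - u * t - s * k + s * t) + (v * e + + 25 * (e * e))
  coset k t e u v s refl = lemma k t e u s
    where
    lemma : ∀ k t e u s → + 25 * ((k - t + e) * (k - t + e)) + (u - s - + 50 * e) * (k - t + e) ≡
      (+ 25 * (k * k) + u * k) + (+ 25 * (t * t) - + 50 * (k * t) - u * t - s * k + s * t)
      + ((u - s - + 50 * e) * e + + 25 * (e * e))
    lemma = solve-∀

  +-self-injective : ∀ {m n} → + m + + m ≡ + n + + n → m ≡ n
  +-self-injective {m} {n} eq = trans (ℕ.n≡⌊n+n/2⌋ m) (trans (cong ⌊_/2⌋ (ℤ.+-injective eq)) (sym (ℕ.n≡⌊n+n/2⌋ n)))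

  totalExponent-double : ∀ x r₁ r₂ r₃ r₄ k₁ k₂ k₃ k₄ → let E = totalExponent (r₁ , r₂ , r₃ , r₄) (k₁ , k₂ , k₃ , k₄) in
    + (x ℕ.+ E) + + (x ℕ.+ E) ≡ + x + + x + total
      (+ 25 * (k₁ * k₁) + slope r₁ * k₁ , + 25 * (k₂ * k₂) + slope r₂ * k₂ ,
       + 25 * (k₃ * k₃) + slope r₃ * k₃ , + 25 * (k₄ * k₄) + slope r₄ * k₄)
  totalExponent-double x r₁ r₂ r₃ r₄ k₁ k₂ k₃ k₄ = trans
    (lemma (+ x) (+ residueExponent r₁ k₁) (+ residueExponent r₂ k₂) (+ residueExponent r₃ k₃) (+ residueExponent r₄ k₄))
    (cong (_+_ (+ x + + x)) (cong₂ _+_ (residueExponent-double r₁ k₁) (cong₂ _+_ (residueExponent-double r₂ k₂)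
      (cong₂ _+_ (residueExponent-double r₃ k₃) (residueExponent-double r₄ k₄)))))
    where
    lemma : ∀ x a b c d → (x + (a + (b + (c + d)))) + (x + (a + (b + (c + d)))) ≡
      x + x + ((a + a) + ((b + b) + ((c + c) + (d + d))))
    lemma = solve-∀

  module _ {x R π x′ R′ π′ e f} (ρ : Reflection x R π x′ R′ π′ e f) (b′ : Bit π′) where
    open Reflection ρ

    translate-total : ∀ k → HasBit π (total k) →
      total (translate e k) ≡ (f - ⌊ total k /2⌋ℤ) + (f - ⌊ total k /2⌋ℤ) + π′
    translate-total k@(k₁ , k₂ , k₃ , k₄) p = begin
      total (translate e k)
        ≡⟨ lemma₁ k₁ k₂ k₃ k₄ (proj₁ e) (proj₁ (proj₂ e)) (proj₁ (proj₂ (proj₂ e))) (proj₂ (proj₂ (proj₂ e))) t ⟩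
      total k - + 4 * t + total e
        ≡⟨ cong (λ s → s - + 4 * t + total e) p ⟩
      t + t + π - + 4 * t + total e
        ≡⟨ lemma₂ t π (total e) ⟩
      (π + total e) - (t + t)
        ≡⟨ cong (_- (t + t)) bits ⟩
      f + f + π′ - (t + t)
        ≡⟨ lemma₃ f t π′ ⟩
      (f - t) + (f - t) + π′ ∎
      where
      open ≡-Reasoning
      t = ⌊ total k /2⌋ℤ
      lemma₁ : ∀ a b c d a′ b′ c′ d′ t → (a - t + a′) + ((b - t + b′) + ((c - t + c′) + (d - t + d′))) ≡
        (a + (b + (c + d))) - + 4 * t + (a′ + (b′ + (c′ + d′)))
      lemma₁ = solve-∀
      lemma₂ : ∀ t p e → t + t + p - + 4 * t + e ≡ (p + e) - (t + t)
      lemma₂ = solve-∀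
      lemma₃ : ∀ f t p → f + f + p - (t + t) ≡ (f - t) + (f - t) + p
      lemma₃ = solve-∀

    translate-half : ∀ k → HasBit π (total k) → ⌊ total (translate e k) /2⌋ℤ ≡ f - ⌊ total k /2⌋ℤ
    translate-half k p = ⌊/2⌋-unique b′ _ (translate-total k p)

    -- A reflection preserves the length of 50 k + slope. The exponents then differ by a constant
    -- coming from the slopes, which is what the field `shift` compensates with x and x′.
    translate-exponent : ∀ k → HasBit π (total k) →
      x′ ℕ.+ totalExponent R′ (translate e k) ≡ x ℕ.+ totalExponent R k
    translate-exponent k@(k₁ , k₂ , k₃ , k₄) p = +-self-injective (begin
      + (x′ ℕ.+ totalExponent R′ (translate e k)) + + (x′ ℕ.+ totalExponent R′ (translate e k))
        ≡⟨ totalExponent-double x′ (proj₁ R′) (proj₁ (proj₂ R′)) (proj₁ (proj₂ (proj₂ R′))) (proj₂ (proj₂ (proj₂ R′)))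
             (k₁ - t + e₁) (k₂ - t + e₂) (k₃ - t + e₃) (k₄ - t + e₄) ⟩
      + x′ + + x′ + total (q (k₁ - t + e₁) v₁ , q (k₂ - t + e₂) v₂ , q (k₃ - t + e₃) v₃ , q (k₄ - t + e₄) v₄)
        ≡⟨ cong (_+_ (+ x′ + + x′)) (cong₂ _+_ (coset k₁ t e₁ u₁ v₁ s slope₁) (cong₂ _+_ (coset k₂ t e₂ u₂ v₂ s slope₂)
             (cong₂ _+_ (coset k₃ t e₃ u₃ v₃ s slope₃) (coset k₄ t e₄ u₄ v₄ s slope₄)))) ⟩
      + x′ + + x′ + total (q k₁ u₁ + c k₁ u₁ + w v₁ e₁ , q k₂ u₂ + c k₂ u₂ + w v₂ e₂ ,
                           q k₃ u₃ + c k₃ u₃ + w v₃ e₃ , q k₄ u₄ + c k₄ u₄ + w v₄ e₄)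
        ≡⟨ gather (+ x′ + + x′) (q k₁ u₁) (q k₂ u₂) (q k₃ u₃) (q k₄ u₄) (c k₁ u₁) (c k₂ u₂) (c k₃ u₃) (c k₄ u₄)
             (w v₁ e₁) (w v₂ e₂) (w v₃ e₃) (w v₄ e₄) ⟩
      total (q k₁ u₁ , q k₂ u₂ , q k₃ u₃ , q k₄ u₄) + total (c k₁ u₁ , c k₂ u₂ , c k₃ u₃ , c k₄ u₄)
        + (total (w v₁ e₁ , w v₂ e₂ , w v₃ e₃ , w v₄ e₄) + (+ x′ + + x′))
        -- Substituting 2 t + π for the sum of k and 2 h for the sum of the slopes removes every t,
        -- and only - s π survives.
        ≡⟨ cong (λ y → total (q k₁ u₁ , q k₂ u₂ , q k₃ u₃ , q k₄ u₄) + y + W)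
             (trans (collect k₁ k₂ k₃ k₄ u₁ u₂ u₃ u₄ s t) (trans
               (cong₂ (λ K U → + 100 * (t * t) - + 50 * (K * t) - U * t - s * K + + 4 * (s * t)) p slopes-even)
               (cancel t π h))) ⟩
      total (q k₁ u₁ , q k₂ u₂ , q k₃ u₃ , q k₄ u₄) + - (s * π) + W
        ≡⟨ swap _ (s * π) (total (w v₁ e₁ , w v₂ e₂ , w v₃ e₃ , w v₄ e₄)) (+ x′ + + x′) ⟩
      (total (w v₁ e₁ , w v₂ e₂ , w v₃ e₃ , w v₄ e₄) - s * π + (+ x′ + + x′)) + total (q k₁ u₁ , q k₂ u₂ , q k₃ u₃ , q k₄ u₄)
        ≡⟨ cong (_+ total (q k₁ u₁ , q k₂ u₂ , q k₃ u₃ , q k₄ u₄)) shift ⟩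
      + x + + x + total (q k₁ u₁ , q k₂ u₂ , q k₃ u₃ , q k₄ u₄)
        ≡⟨ totalExponent-double x (proj₁ R) (proj₁ (proj₂ R)) (proj₁ (proj₂ (proj₂ R))) (proj₂ (proj₂ (proj₂ R))) k₁ k₂ k₃ k₄ ⟨
      + (x ℕ.+ totalExponent R k) + + (x ℕ.+ totalExponent R k) ∎)
      where
      open ≡-Reasoning
      t = ⌊ total k /2⌋ℤ
      u₁ = slope (proj₁ R)
      u₂ = slope (proj₁ (proj₂ R))
      u₃ = slope (proj₁ (proj₂ (proj₂ R)))
      u₄ = slope (proj₂ (proj₂ (proj₂ R)))
      v₁ = slope (proj₁ R′)
      v₂ = slope (proj₁ (proj₂ R′))
      v₃ = slope (proj₁ (proj₂ (proj₂ R′)))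
      v₄ = slope (proj₂ (proj₂ (proj₂ R′)))
      e₁ = proj₁ e
      e₂ = proj₁ (proj₂ e)
      e₃ = proj₁ (proj₂ (proj₂ e))
      e₄ = proj₂ (proj₂ (proj₂ e))
      h = ⌊ total (u₁ , u₂ , u₃ , u₄) /2⌋ℤ
      s = + 25 * π + h
      q : ℤ → ℤ → ℤ
      q k u = + 25 * (k * k) + u * k
      c : ℤ → ℤ → ℤ
      c k u = + 25 * (t * t) - + 50 * (k * t) - u * t - s * k + s * t
      w : ℤ → ℤ → ℤ
      w v e = v * e + + 25 * (e * e)
      W = total (w v₁ e₁ , w v₂ e₂ , w v₃ e₃ , w v₄ e₄) + (+ x′ + + x′)
      gather : ∀ x q₁ q₂ q₃ q₄ c₁ c₂ c₃ c₄ w₁ w₂ w₃ w₄ →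
        x + ((q₁ + c₁ + w₁) + ((q₂ + c₂ + w₂) + ((q₃ + c₃ + w₃) + (q₄ + c₄ + w₄)))) ≡
        (q₁ + (q₂ + (q₃ + q₄))) + (c₁ + (c₂ + (c₃ + c₄))) + ((w₁ + (w₂ + (w₃ + w₄))) + x)
      gather = solve-∀
      collect : ∀ k₁ k₂ k₃ k₄ u₁ u₂ u₃ u₄ s t →
        (+ 25 * (t * t) - + 50 * (k₁ * t) - u₁ * t - s * k₁ + s * t) + ((+ 25 * (t * t) - + 50 * (k₂ * t) - u₂ * t - s * k₂ + s * t)
        + ((+ 25 * (t * t) - + 50 * (k₃ * t) - u₃ * t - s * k₃ + s * t) + (+ 25 * (t * t) - + 50 * (k₄ * t) - u₄ * t - s * k₄ + s * t)))
        ≡ + 100 * (t * t) - + 50 * ((k₁ + (k₂ + (k₃ + k₄))) * t) - (u₁ + (u₂ + (u₃ + u₄))) * t - s * (k₁ + (k₂ + (k₃ + k₄))) + + 4 * (s * t)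
      collect = solve-∀
      cancel : ∀ t π h → + 100 * (t * t) - + 50 * ((t + t + π) * t) - (h + h) * t - (+ 25 * π + h) * (t + t + π)
        + + 4 * ((+ 25 * π + h) * t) ≡ - ((+ 25 * π + h) * π)
      cancel = solve-∀
      swap : ∀ q p w x → q + - p + (w + x) ≡ (w - p + x) + q
      swap = solve-∀

  complement : ℤ → Point → Point
  complement f (e₁ , e₂ , e₃ , e₄) = f - e₁ , f - e₂ , f - e₃ , f - e₄

  -- A reflection is its own inverse. Since the half changes from t to f - t, translating back takes
  -- f - e in place of e.
  translate-inverse : ∀ f e k → ⌊ total (translate e k) /2⌋ℤ ≡ f - ⌊ total k /2⌋ℤ →
    translate (complement f e) (translate e k) ≡ k
  translate-inverse f (e₁ , e₂ , e₃ , e₄) k@(k₁ , k₂ , k₃ , k₄) eq =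
    cong₂ _,_ (back k₁ e₁) (cong₂ _,_ (back k₂ e₂) (cong₂ _,_ (back k₃ e₃) (back k₄ e₄)))
    where
    t = ⌊ total k /2⌋ℤ
    lemma : ∀ k t e f → k - t + e - (f - t) + (f - e) ≡ k
    lemma = solve-∀
    back : ∀ k e → _ ≡ k
    back k e = trans (cong (λ t′ → k - t + e - t′ + (f - e)) eq) (lemma k t e f)

  complement-involutive : ∀ f e → complement f (complement f e) ≡ e
  complement-involutive f (e₁ , e₂ , e₃ , e₄) =
    cong₂ _,_ (lemma f e₁) (cong₂ _,_ (lemma f e₂) (cong₂ _,_ (lemma f e₃) (lemma f e₄)))
    where
    lemma : ∀ f e → f - (f - e) ≡ e
    lemma = solve-∀

  -- The conditions are also assumed for the way back; for numerical residues they are checked by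
  -- evaluation, like those for the way there.
  solutions-reflection : ∀ {M x R π x′ R′ π′ e f n} → Bit π → Bit π′ → Reflection x R π x′ R′ π′ e f →
    Reflection x′ R′ π′ x R π (complement f e) f → n ≤ M → solutions M x R π n ≡ solutions M x′ R′ π′ n
  solutions-reflection {M} {x} {R} {π} {x′} {R′} {π′} {e} {f} {n} b b′ ρ ρ′ n≤M =
    length-filter-↔ (solution? x R π n) (solution? x′ R′ π′ n) (box-unique M) (box-unique M)
      (solution-∈-box x R n≤M) (solution-∈-box x′ R′ n≤M) (translate e) (translate (complement f e))
      (λ {k} (p , q) → trans (translate-exponent ρ b′ k q) p , hasBit b′ (f - ⌊ total k /2⌋ℤ) (translate-total ρ b′ k q))
      (λ {k} (p , q) → trans (translate-exponent ρ′ b k q) p , hasBit b (f - ⌊ total k /2⌋ℤ) (translate-total ρ′ b k q))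
      (λ {k} (p , q) → translate-inverse f e k (translate-half ρ b′ k q))
      (λ {k} (p , q) → subst (λ e′ → translate e′ (translate (complement f e) k) ≡ k) (complement-involutive f e)
        (translate-inverse f (complement f e) k (translate-half ρ′ b k q)))

  open _≈[_]_

  -- Products of four theta series

  weight : ℤ → Point → ℤ
  weight ε (k₁ , k₂ , k₃ , k₄) = ε ^ ∣ k₁ ∣ * (ε ^ ∣ k₂ ∣ * (ε ^ ∣ k₃ ∣ * ε ^ ∣ k₄ ∣))

  data Sign : ℤ → Set where
    positive : Sign 1ℤ
    negative : Sign -1ℤ

  sign-square : ∀ {ε} → Sign ε → ε * ε ≡ 1ℤ
  sign-square positive = refl
  sign-square negative = refl

  weight-positive : ∀ k → weight 1ℤ k ≡ 1ℤ
  weight-positive (k₁ , k₂ , k₃ , k₄) = cong₂ _*_ (ℤ.^-zeroˡ ∣ k₁ ∣)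
    (cong₂ _*_ (ℤ.^-zeroˡ ∣ k₂ ∣) (cong₂ _*_ (ℤ.^-zeroˡ ∣ k₃ ∣) (ℤ.^-zeroˡ ∣ k₄ ∣)))

  weight-negative : ∀ k → weight -1ℤ k ≡ parity (total k)
  weight-negative (k₁ , k₂ , k₃ , k₄) = trans (cong (parity k₁ *_) (trans (cong (parity k₂ *_) (parity-+ k₃ k₄))
    (parity-+ k₂ (k₃ + k₄)))) (parity-+ k₁ (k₂ + (k₃ + k₄)))

  weight-even : ∀ {ε} → Sign ε → ∀ k → HasBit 0ℤ (total k) → weight ε k ≡ 1ℤ
  weight-even positive k p = weight-positive k
  weight-even negative k p = trans (weight-negative k) (parity-even ⌊ total k /2⌋ℤ p)

  weight-odd : ∀ {ε} → Sign ε → ∀ k → HasBit 1ℤ (total k) → weight ε k ≡ ε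
  weight-odd positive k p = weight-positive k
  weight-odd negative k p = trans (weight-negative k) (parity-odd ⌊ total k /2⌋ℤ p)

  thetaProduct₄ : ℤ → ℕ → Residues → Series
  thetaProduct₄ ε M (r₁ , r₂ , r₃ , r₄) = θ r₁ · (θ r₂ · (θ r₃ · θ r₄))
    where
    θ : Residue → Series
    θ r = thetaProduct ε (Residue.low r) (Residue.high r) M

  qFactorial⁴ : ℕ → Series
  qFactorial⁴ M = qFactorial M · (qFactorial M · (qFactorial M · qFactorial M))

  qFactorial⁴-constant : ∀ M → qFactorial⁴ M 0 ≡ 1ℤ
  qFactorial⁴-constant M = cong (λ j → j * (j * (j * j))) (qFactorial-constant M)

  module _ (N : ℕ) where
    open CommutativeSemiring (truncatedSeries N) using (setoid; *-congˡ; *-cong; +-cong) renaming (refl to ≈-refl; sym to ≈-sym; trans to ≈-trans)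
    open SetoidReasoning setoid
    open SemiringSolver (truncatedSeries N) using (solve; _:=_; _:*_; _:+_)
    open BigSums (truncatedSeries N) using (∑; ∑-cong; ∑-*-∑; *-distribˡ-∑)

    -- The weight of a point depends only on the parity of its total: 1 if even, ε if odd. From here
    -- on the theta relation is a statement about numbers of points.
    ∑-coefficient : ∀ {ε} → Sign ε → ∀ x R n (ks : List Point) →
      ∑ ks (λ k → monomial (weight ε k) (x ℕ.+ totalExponent R k)) n ≡
      + length (filter (solution? x R 0ℤ n) ks) + ε * + length (filter (solution? x R 1ℤ n) ks)
    ∑-coefficient {ε} σ x R n []       = sym (trans (ℤ.+-identityˡ (ε * 0ℤ)) (ℤ.*-zeroʳ ε))
    ∑-coefficient {ε} σ x R n (k ∷ ks) = trans (⊕-coefficient (monomial w e) _ n)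
        (trans (cong (_+_ (monomial w e n)) (∑-coefficient σ x R n ks)) (cases (e ℕ.≟ n) (bit (total k))))
      where
      w = weight ε k
      e = x ℕ.+ totalExponent R k
      #₀ = length (filter (solution? x R 0ℤ n) ks)
      #₁ = length (filter (solution? x R 1ℤ n) ks)
      lemma₀ : ∀ a b → 1ℤ + (a + b) ≡ 1ℤ + a + b
      lemma₀ = solve-∀
      lemma₁ : ∀ ε a b → ε + (a + ε * b) ≡ a + ε * (1ℤ + b)
      lemma₁ = solve-∀
      cases : Dec (e ≡ n) → HasBit 0ℤ (total k) ⊎ HasBit 1ℤ (total k) → monomial w e n + (+ #₀ + ε * + #₁) ≡
        + length (filter (solution? x R 0ℤ n) (k ∷ ks)) + ε * + length (filter (solution? x R 1ℤ n) (k ∷ ks))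
      cases (no e≢n) _ = trans
        (trans (cong (_+ (+ #₀ + ε * + #₁)) (monomial-≢ w e (e≢n ∘ sym))) (ℤ.+-identityˡ _))
        (sym (cong₂ (λ ks₀ ks₁ → + length ks₀ + ε * + length ks₁)
          (filter-reject (solution? x R 0ℤ n) (e≢n ∘ proj₁)) (filter-reject (solution? x R 1ℤ n) (e≢n ∘ proj₁))))
      cases (yes refl) (inj₁ p) = trans
        (trans (cong (_+ (+ #₀ + ε * + #₁)) (trans (monomial-coefficient w e) (weight-even σ k p))) (lemma₀ (+ #₀) (ε * + #₁)))
        (sym (cong₂ (λ ks₀ ks₁ → + length ks₀ + ε * + length ks₁)
          (filter-accept (solution? x R 0ℤ n) (refl , p))
          (filter-reject (solution? x R 1ℤ n) (bits-exclusive (total k) p ∘ proj₂))))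
      cases (yes refl) (inj₂ p) = trans
        (trans (cong (_+ (+ #₀ + ε * + #₁)) (trans (monomial-coefficient w e) (weight-odd σ k p))) (lemma₁ ε (+ #₀) (+ #₁)))
        (sym (cong₂ (λ ks₀ ks₁ → + length ks₀ + ε * + length ks₁)
          (filter-reject (solution? x R 0ℤ n) (λ q → bits-exclusive (total k) (proj₂ q) p))
          (filter-accept (solution? x R 1ℤ n) (refl , p))))

    thetaSum : ℤ → ℕ → Residue → Series
    thetaSum ε M r = ∑ (interval M) (thetaMonomial ε (Residue.low r) (Residue.high r))

    thetaSum₄ : ℤ → ℕ → Residues → Series
    thetaSum₄ ε M (r₁ , r₂ , r₃ , r₄) = thetaSum ε M r₁ · (thetaSum ε M r₂ · (thetaSum ε M r₃ · thetaSum ε M r₄))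

    thetaSum₄-∑ : ∀ ε M x R → monomial 1ℤ x · thetaSum₄ ε M R ≈[ N ]
      ∑ (box M) (λ k → monomial (weight ε k) (x ℕ.+ totalExponent R k))
    thetaSum₄-∑ ε M x R@(r₁ , r₂ , r₃ , r₄) = begin
      monomial 1ℤ x · thetaSum₄ ε M R
        ≈⟨ *-congˡ (≈-trans (*-congˡ (≈-trans (*-congˡ (∑-*-∑ I I (θ r₃) (θ r₄)))
             (∑-*-∑ I (cartesianProduct I I) (θ r₂) _))) (∑-*-∑ I (cartesianProduct I (cartesianProduct I I)) (θ r₁) _)) ⟩
      monomial 1ℤ x · ∑ (box M) (λ (k₁ , k₂ , k₃ , k₄) → θ r₁ k₁ · (θ r₂ k₂ · (θ r₃ k₃ · θ r₄ k₄)))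
        ≈⟨ *-distribˡ-∑ (monomial 1ℤ x) (box M) _ ⟩
      ∑ (box M) (λ (k₁ , k₂ , k₃ , k₄) → monomial 1ℤ x · (θ r₁ k₁ · (θ r₂ k₂ · (θ r₃ k₃ · θ r₄ k₄))))
        ≈⟨ ∑-cong (box M) (λ k → merge k) ⟩
      ∑ (box M) (λ k → monomial (weight ε k) (x ℕ.+ totalExponent R k)) ∎
      where
      I = interval M
      θ : Residue → ℤ → Series
      θ r = thetaMonomial ε (Residue.low r) (Residue.high r)
      times : ∀ c e d e′ {g} → g ≈[ N ] monomial d e′ → monomial c e · g ≈[ N ] monomial (c * d) (e ℕ.+ e′)
      times c e d e′ p = ≈-trans (*-congˡ p) (exact (monomial-·-monomial c e d e′))
      merge : ∀ k → monomial 1ℤ x · (θ r₁ (proj₁ k) · (θ r₂ (proj₁ (proj₂ k)) · (θ r₃ (proj₁ (proj₂ (proj₂ k))) · θ r₄ (proj₂ (proj₂ (proj₂ k))))))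
              ≈[ N ] monomial (weight ε k) (x ℕ.+ totalExponent R k)
      merge k@(k₁ , k₂ , k₃ , k₄) = ≈-trans
        (times 1ℤ x (weight ε k) (totalExponent R k)
          (times (s k₁) (e r₁ k₁) (s k₂ * (s k₃ * s k₄)) (e r₂ k₂ ℕ.+ (e r₃ k₃ ℕ.+ e r₄ k₄))
            (times (s k₂) (e r₂ k₂) (s k₃ * s k₄) (e r₃ k₃ ℕ.+ e r₄ k₄)
              (times (s k₃) (e r₃ k₃) (s k₄) (e r₄ k₄) ≈-refl))))
        (exact λ n → cong (λ c → monomial c (x ℕ.+ totalExponent R k) n) (ℤ.*-identityˡ (weight ε k)))
        where
        s : ℤ → ℤ
        s k = ε ^ ∣ k ∣
        e : Residue → ℤ → ℕ
        e = residueExponent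

    thetaSum₄-coefficient : ∀ {ε} → Sign ε → ∀ M x R {n} → n < N →
      (monomial 1ℤ x · thetaSum₄ ε M R) n ≡ + solutions M x R 0ℤ n + ε * + solutions M x R 1ℤ n
    thetaSum₄-coefficient {ε} σ M x R {n} n<N =
      trans (coefficient (thetaSum₄-∑ ε M x R) n n<N) (∑-coefficient σ x R n (box M))

    thetaProduct₄-thetaSum₄ : ∀ {ε} → Sign ε → ∀ M R → N ≤ M →
      qFactorial⁴ M · thetaProduct₄ ε M R ≈[ N ] thetaSum₄ ε M R
    thetaProduct₄-thetaSum₄ {ε} σ M (r₁ , r₂ , r₃ , r₄) N≤M = ≈-trans
      (solve 5 (λ j a b c d → (j :* (j :* (j :* j))) :* (a :* (b :* (c :* d))) :=
        (j :* a) :* ((j :* b) :* ((j :* c) :* (j :* d)))) ≈-refl (qFactorial M) _ _ _ _)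
      (*-cong (θ r₁) (*-cong (θ r₂) (*-cong (θ r₃) (θ r₄))))
      where
      θ : ∀ r → qFactorial M · thetaProduct ε (Residue.low r) (Residue.high r) M ≈[ N ] thetaSum ε M r
      θ r = thetaProduct-∑ N ε (sign-square σ) (Residue.low⁻ r) (Residue.high⁻ r) (Residue.complementary r) M N≤M

  -- The quartic theta relation

  data Classes : ℤ → ℤ → Set where
    even-odd : Classes 0ℤ 1ℤ
    odd-even : Classes 1ℤ 0ℤ

  bit₁ : ∀ {π π̄} → Classes π π̄ → Bit π
  bit₁ even-odd = even
  bit₁ odd-even = odd

  bit₂ : ∀ {π π̄} → Classes π π̄ → Bit π̄
  bit₂ even-odd = odd
  bit₂ odd-even = even

  module _ {π π̄ ρ ρ̄ y z P Q C e₁ f₁ e₂ f₂ e₃ f₃}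
    (cπ : Classes π π̄) (cρ : Classes ρ ρ̄)
    (PC : Reflection 0 (oppositeFirst P) π z C 0ℤ e₁ f₁)
    (CP : Reflection z C 0ℤ 0 (oppositeFirst P) π (complement f₁ e₁) f₁)
    (PQ : Reflection 0 P π̄ y Q ρ e₂ f₂)
    (QP : Reflection y Q ρ 0 P π̄ (complement f₂ e₂) f₂)
    (QC : Reflection y (oppositeFirst Q) ρ̄ z (oppositeFirst C) 1ℤ e₃ f₃)
    (CQ : Reflection z (oppositeFirst C) 1ℤ y (oppositeFirst Q) ρ̄ (complement f₃ e₃) f₃) where

    -- Writing halves as indices, P_π = C_0, P_π̄ = Q_ρ and Q_ρ̄ = C_1. So P = C_0 + Q_ρ, and adding
    -- and subtracting C_1 = Q_ρ̄ gives Q + (C_0 - C_1).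
    solutions-relation : ∀ {M n} → n ≤ M →
      + solutions M 0 P 0ℤ n + 1ℤ * + solutions M 0 P 1ℤ n ≡
      (+ solutions M y Q 0ℤ n + 1ℤ * + solutions M y Q 1ℤ n) + (+ solutions M z C 0ℤ n + -1ℤ * + solutions M z C 1ℤ n)
    solutions-relation {M} {n} n≤M = begin
      + solutions M 0 P 0ℤ n + 1ℤ * + solutions M 0 P 1ℤ n
        ≡⟨ split cπ 0 P ⟩
      + solutions M 0 P π n + + solutions M 0 P π̄ n
        ≡⟨ cong₂ (λ a b → + a + + b)
             (trans (sym (solutions-oppositeFirst {M} {0} {P} (bit₁ cπ) n≤M)) (solutions-reflection (bit₁ cπ) even PC CP n≤M))
             (solutions-reflection (bit₂ cπ) (bit₁ cρ) PQ QP n≤M) ⟩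
      + solutions M z C 0ℤ n + + solutions M y Q ρ n
        ≡⟨ lemma (+ solutions M z C 0ℤ n) (+ solutions M y Q ρ n) (+ solutions M z C 1ℤ n) ⟩
      (+ solutions M y Q ρ n + + solutions M z C 1ℤ n) + (+ solutions M z C 0ℤ n + -1ℤ * + solutions M z C 1ℤ n)
        ≡⟨ cong (λ a → (+ solutions M y Q ρ n + + a) + (+ solutions M z C 0ℤ n + -1ℤ * + solutions M z C 1ℤ n))
             (trans (sym (solutions-oppositeFirst {M} {z} {C} odd n≤M)) (trans
               (sym (solutions-reflection (bit₂ cρ) odd QC CQ n≤M))
               (solutions-oppositeFirst {M} {y} {Q} (bit₂ cρ) n≤M))) ⟩
      (+ solutions M y Q ρ n + + solutions M y Q ρ̄ n) + (+ solutions M z C 0ℤ n + -1ℤ * + solutions M z C 1ℤ n)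
        ≡⟨ cong (_+ _) (split cρ y Q) ⟨
      (+ solutions M y Q 0ℤ n + 1ℤ * + solutions M y Q 1ℤ n) + (+ solutions M z C 0ℤ n + -1ℤ * + solutions M z C 1ℤ n) ∎
      where
      open ≡-Reasoning
      lemma : ∀ a b c → a + b ≡ (b + c) + (a + -1ℤ * c)
      lemma = solve-∀
      split : ∀ {π π̄} → Classes π π̄ → ∀ x R → + solutions M x R 0ℤ n + 1ℤ * + solutions M x R 1ℤ n ≡
              + solutions M x R π n + + solutions M x R π̄ n
      split even-odd x R = cong (_+_ (+ solutions M x R 0ℤ n)) (ℤ.*-identityˡ (+ solutions M x R 1ℤ n))
      split odd-even x R = trans (cong (_+_ (+ solutions M x R 0ℤ n)) (ℤ.*-identityˡ (+ solutions M x R 1ℤ n)))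
        (ℤ.+-comm (+ solutions M x R 0ℤ n) (+ solutions M x R 1ℤ n))

    theta-relation : ∀ N M → N ≤ M →
      thetaProduct₄ 1ℤ M P ≈[ N ] monomial 1ℤ y · thetaProduct₄ 1ℤ M Q ⊕ monomial 1ℤ z · thetaProduct₄ -1ℤ M C
    theta-relation N M N≤M = ·-cancelˡ (qFactorial⁴-constant M) (begin
      J · thetaProduct₄ 1ℤ M P
        ≈⟨ ≈-trans (thetaProduct₄-thetaSum₄ N positive M P N≤M) (≈-sym (*-identityˡ _)) ⟩
      𝟏 · thetaSum₄ N 1ℤ M P
        ≈⟨ agree (λ n n<N → trans (thetaSum₄-coefficient N positive M 0 P n<N)
             (trans (solutions-relation (ℕ.≤-trans (ℕ.<⇒≤ n<N) N≤M)) (sym (trans (⊕-coefficient _ _ n)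
               (cong₂ _+_ (thetaSum₄-coefficient N positive M y Q n<N) (thetaSum₄-coefficient N negative M z C n<N)))))) ⟩
      monomial 1ℤ y · thetaSum₄ N 1ℤ M Q ⊕ monomial 1ℤ z · thetaSum₄ N -1ℤ M C
        ≈⟨ +-cong (*-congˡ (thetaProduct₄-thetaSum₄ N positive M Q N≤M)) (*-congˡ (thetaProduct₄-thetaSum₄ N negative M C N≤M)) ⟨
      monomial 1ℤ y · (J · thetaProduct₄ 1ℤ M Q) ⊕ monomial 1ℤ z · (J · thetaProduct₄ -1ℤ M C)
        ≈⟨ solve 5 (λ j y q z c → y :* (j :* q) :+ z :* (j :* c) := j :* (y :* q :+ z :* c)) ≈-refl
             J (monomial 1ℤ y) (thetaProduct₄ 1ℤ M Q) (monomial 1ℤ z) (thetaProduct₄ -1ℤ M C) ⟩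
      J · (monomial 1ℤ y · thetaProduct₄ 1ℤ M Q ⊕ monomial 1ℤ z · thetaProduct₄ -1ℤ M C) ∎)
      where
      J = qFactorial⁴ M
      open CommutativeSemiring (truncatedSeries N) using (setoid; *-congˡ; *-identityˡ; +-cong) renaming (refl to ≈-refl; sym to ≈-sym; trans to ≈-trans)
      open SetoidReasoning setoid
      open SemiringSolver (truncatedSeries N) using (solve; _:=_; _:*_; _:+_)

-- Partitions

module _ where
  open import Data.Nat using (_+_; _*_)
  open ℕ-Solver using (solve-∀)
  open JacobiTriple powerSeries using (pochhammer)

  mutual
    -- The local function of pLe cannot be named outside Defs; comparing both sides of pLe-partsFrom
    -- makes unification find it.
    partsFrom : PosSet → ℕ → ℕ → ℕ → ℕ
    partsFrom = _

    pLe-partsFrom : ∀ S k n → S (suc k) ≡ true →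
      pLe S (suc k) (suc n) ≡ pLe S k (suc n) + (if n <ᵇ k then 0 else partsFrom S k n (n ∸ k))
    pLe-partsFrom S k n k+1∈S with S (suc k) | n ∸ k
    pLe-partsFrom S k n refl | true | m = refl

  -- Each step lowers m by at least 1, so any fuel of at least m gives the same sum.
  partsFrom-fuel : ∀ S k f f′ {m} → m ≤ f → m ≤ f′ → partsFrom S k f m ≡ partsFrom S k f′ m
  partsFrom-fuel S k zero    zero     z≤n z≤n = refl
  partsFrom-fuel S k zero    (suc f′) z≤n z≤n = sym (ℕ.+-identityʳ _)
  partsFrom-fuel S k (suc f) zero     z≤n z≤n = ℕ.+-identityʳ _
  partsFrom-fuel S k (suc f) (suc f′) {m} m≤f m≤f′ =
    cong (λ r → pLe S k m + (if m <ᵇ suc k then 0 else r))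
      (partsFrom-fuel S k f f′ (less m≤f) (less m≤f′))
    where
    less : ∀ {f} → m ≤ suc f → m ∸ suc k ≤ f
    less m≤f = ℕ.≤-trans (ℕ.∸-monoˡ-≤ (suc k) m≤f) (ℕ.m∸n≤m _ k)

  pLe≡partsFrom : ∀ S k n → S (suc k) ≡ true → pLe S (suc k) n ≡ partsFrom S k n n
  pLe≡partsFrom S k zero    k+1∈S with S (suc k)
  pLe≡partsFrom S k zero    refl | true = refl
  pLe≡partsFrom S k (suc n) k+1∈S = pLe-partsFrom S k n k+1∈S

  -- Removing one copy of the part k + 1 replaces the sum over multiplicities by a two-term
  -- recurrence, the form that multiplication by 1 - q^(k + 1) can use.
  pLe-recurrence : ∀ S k n → S (suc k) ≡ true →
    pLe S (suc k) n ≡ pLe S k n + (if n <ᵇ suc k then 0 else pLe S (suc k) (n ∸ suc k))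
  pLe-recurrence S k n k+1∈S = begin
    pLe S (suc k) n
      ≡⟨ pLe≡partsFrom S k n k+1∈S ⟩
    partsFrom S k n n
      ≡⟨ partsFrom-fuel S k n (suc n) ℕ.≤-refl (ℕ.n≤1+n n) ⟩
    pLe S k n + (if n <ᵇ suc k then 0 else partsFrom S k n (n ∸ suc k))
      ≡⟨ cong (λ r → pLe S k n + (if n <ᵇ suc k then 0 else r)) (trans
           (partsFrom-fuel S k n (n ∸ suc k) (ℕ.m∸n≤m n (suc k)) ℕ.≤-refl)
           (sym (pLe≡partsFrom S k (n ∸ suc k) k+1∈S))) ⟩
    pLe S k n + (if n <ᵇ suc k then 0 else pLe S (suc k) (n ∸ suc k)) ∎
    where open ≡-Reasoning

  pLe-absent : ∀ S k n → S (suc k) ≡ false → pLe S (suc k) n ≡ pLe S k n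
  pLe-absent S k n k+1∉S with S (suc k)
  pLe-absent S k n refl | false = refl

  <⇒<ᵇ≡true : ∀ {m n} → m < n → (m <ᵇ n) ≡ true
  <⇒<ᵇ≡true {zero}  {suc n} _         = refl
  <⇒<ᵇ≡true {suc m} {suc n} (s≤s m<n) = <⇒<ᵇ≡true m<n

  ≥⇒<ᵇ≡false : ∀ {m n} → n ≤ m → (m <ᵇ n) ≡ false
  ≥⇒<ᵇ≡false {m}     {zero}  _         = refl
  ≥⇒<ᵇ≡false {suc m} {suc n} (s≤s n≤m) = ≥⇒<ᵇ≡false n≤m

  pLe-large : ∀ S k n → n ≤ k → pLe S (suc k) n ≡ pLe S k n
  pLe-large S k n n≤k = cases (S (suc k)) refl
    where
    cases : ∀ b → S (suc k) ≡ b → pLe S (suc k) n ≡ pLe S k n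
    cases false k+1∉S = pLe-absent S k n k+1∉S
    cases true  k+1∈S = trans (pLe-recurrence S k n k+1∈S) (trans
      (cong (λ b → pLe S k n + (if b then 0 else pLe S (suc k) (n ∸ suc k))) (<⇒<ᵇ≡true (s≤s n≤k)))
      (ℕ.+-identityʳ _))

  pLe-stable : ∀ S d n → pLe S (d + n) n ≡ p S n
  pLe-stable S zero    n = refl
  pLe-stable S (suc d) n = trans (pLe-large S (d + n) n (ℕ.m≤n+m n d)) (pLe-stable S d n)

  -- Generating functions and products over residue classes

  generating : PosSet → ℕ → Series
  generating S k n = + pLe S k n

  factor : ℤ → ℕ → Series
  factor ε s = 𝟏 ⊕ monomial ε s

  partFactor : PosSet → ℕ → Series
  partFactor S s = if S s then factor -1ℤ s else 𝟏

  monomial-cancel : ∀ s n → (monomial 1ℤ s ⊕ monomial -1ℤ s) n ≡ 0ℤ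
  monomial-cancel zero    zero    = refl
  monomial-cancel zero    (suc n) = ⊕-coefficient 𝟎 𝟎 n
  monomial-cancel (suc s) zero    = refl
  monomial-cancel (suc s) (suc n) = monomial-cancel s n

  residues double : Residue → List ℕ
  residues r = low ∷ high ∷ 25 + low ∷ 25 + high ∷ []
    where open Residue r using (low; high)
  double r = low + low ∷ high + high ∷ []
    where open Residue r using (low; high)

  module _ (N : ℕ) where
    open CommutativeSemiring (truncatedSeries N)
      using (setoid; *-congˡ; *-congʳ; *-cong; +-cong; +-congˡ; +-congʳ; *-identityˡ; *-identityʳ; *-assoc; *-comm;
             +-identityʳ; zeroˡ; +-comm; *-commutativeMonoid)
      renaming (refl to ≈-refl; sym to ≈-sym; trans to ≈-trans; reflexive to ≈-reflexive)
    open SetoidReasoning setoid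
    open SemiringSolver (truncatedSeries N) using (solve; _:=_; _:*_; _:+_; con)
    open BigOperators *-commutativeMonoid using () renaming
      ( ⨁ to ∏; ⨁-++ to ∏-++; ⨁-↭ to ∏-↭; ⨁-filter to ∏-filter
      ; ⨁< to ∏<; ⨁<-cong to ∏<-cong; ⨁<-∙ to ∏<-·; ⨁<-unit to ∏<-unit; ⨁<-* to ∏<-*; ⨁<-⨁-applyUpTo to ∏<-∏-applyUpTo )

    generating-step : ∀ S k → partFactor S (suc k) · generating S (suc k) ≈[ N ] generating S k
    generating-step S k = cases (S (suc k)) refl
      where
      cases : ∀ b → S (suc k) ≡ b → (if b then factor -1ℤ (suc k) else 𝟏) · generating S (suc k) ≈[ N ] generating S k
      cases false k+1∉S = ≈-trans (*-identityˡ _) (exact λ n → cong +_ (pLe-absent S k n k+1∉S))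
      cases true  k+1∈S = begin
        (𝟏 ⊕ a) · g
          ≈⟨ solve 2 (λ a g → (con 1 :+ a) :* g := g :+ a :* g) ≈-refl a g ⟩
        g ⊕ a · g
          ≈⟨ +-congʳ recurrence ⟩
        (generating S k ⊕ b · g) ⊕ a · g
          ≈⟨ solve 4 (λ a b g h → (h :+ b :* g) :+ a :* g := h :+ (b :+ a) :* g) ≈-refl a b g (generating S k) ⟩
        generating S k ⊕ (b ⊕ a) · g
          ≈⟨ +-congˡ (≈-trans (*-congʳ (exact (monomial-cancel (suc k)))) (zeroˡ g)) ⟩
        generating S k ⊕ 𝟎
          ≈⟨ +-identityʳ _ ⟩
        generating S k ∎
        where
        a = monomial -1ℤ (suc k)
        b = monomial 1ℤ (suc k)
        g = generating S (suc k)
        shifted : ∀ n → n < suc k ⊎ suc k ≤ n → (b · g) n ≡ + (if n <ᵇ suc k then 0 else pLe S (suc k) (n ∸ suc k))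
        shifted n (inj₁ n<k+1) = trans (monomial-·-< 1ℤ (suc k) g n<k+1)
          (cong (λ b → + (if b then 0 else pLe S (suc k) (n ∸ suc k))) (sym (<⇒<ᵇ≡true n<k+1)))
        shifted n (inj₂ k+1≤n) = trans
          (trans (cong (b · g) (sym (ℕ.m+[n∸m]≡n k+1≤n)))
            (trans (monomial-·-+ 1ℤ (suc k) g (n ∸ suc k)) (ℤ.*-identityˡ _)))
          (cong (λ b → + (if b then 0 else pLe S (suc k) (n ∸ suc k))) (sym (≥⇒<ᵇ≡false k+1≤n)))
        recurrence : g ≈[ N ] generating S k ⊕ b · g
        recurrence = exact λ n → trans (cong +_ (pLe-recurrence S k n k+1∈S))
          (trans (cong (ℤ._+_ (generating S k n)) (sym (shifted n (ℕ.<-≤-connex n (suc k)))))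
            (sym (⊕-coefficient (generating S k) (b · g) n)))

    generating-inverse : ∀ S k → ∏< k (partFactor S ∘ suc) · generating S k ≈[ N ] 𝟏
    generating-inverse S zero    = ≈-trans (*-identityˡ _) (exact λ { zero → refl ; (suc n) → refl })
    generating-inverse S (suc k) = begin
      ∏< k (partFactor S ∘ suc) · partFactor S (suc k) · generating S (suc k)   ≈⟨ *-assoc _ _ _ ⟩
      ∏< k (partFactor S ∘ suc) · (partFactor S (suc k) · generating S (suc k)) ≈⟨ *-congˡ (generating-step S k) ⟩
      ∏< k (partFactor S ∘ suc) · generating S k                                ≈⟨ generating-inverse S k ⟩
      𝟏 ∎

    -- ∏ (1 - qⁿ) over the n > 0 congruent modulo 50 to some element of xs ⊆ [1, 50], up to q^N.
    residueProduct : List ℕ → Series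
    residueProduct xs = ∏< N (λ j → ∏ xs (λ x → factor -1ℤ (x + j * 50)))

    residueProduct-++ : ∀ xs ys → residueProduct (xs ++ ys) ≈[ N ] residueProduct xs · residueProduct ys
    residueProduct-++ xs ys = ≈-trans (∏<-cong N (λ j → ∏-++ xs ys _)) (∏<-· N _ _)

    residueProduct-↭ : ∀ {xs ys} → xs ↭ ys → residueProduct xs ≈[ N ] residueProduct ys
    residueProduct-↭ xs↭ys = ∏<-cong N (λ j → ∏-↭ _ xs↭ys)

    residueProduct-constant : ∀ {xs} → All (1 ≤_) xs → residueProduct xs 0 ≡ 1ℤ
    residueProduct-constant {xs} xs≥1 = outer N
      where
      inner : ∀ j {xs} → All (1 ≤_) xs → ∏ xs (λ x → factor -1ℤ (x + j * 50)) 0 ≡ 1ℤ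
      inner j []             = refl
      inner j (s≤s _ ∷ xs≥1) = cong (1ℤ ℤ.*_) (inner j xs≥1)
      outer : ∀ m → ∏< m (λ j → ∏ xs (λ x → factor -1ℤ (x + j * 50))) 0 ≡ 1ℤ
      outer zero    = refl
      outer (suc m) = cong₂ ℤ._*_ (outer m) (inner m xs≥1)

    pochhammer-∏ : ∀ ε α m → pochhammer X (monomial ε α) m ≈[ N ] ∏< m (λ j → factor ε (α + j * 25))
    pochhammer-∏ ε α zero    = ≈-refl
    pochhammer-∏ ε α (suc m) = *-cong (pochhammer-∏ ε α m) (+-congˡ (exact (monomial-·-X-^ ε α m)))

    thetaProduct-∏ : ∀ ε α β m → thetaProduct ε α β m ≈[ N ] ∏< m (λ j → factor ε (α + j * 25) · factor ε (β + j * 25))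
    thetaProduct-∏ ε α β m = ≈-trans (*-cong (pochhammer-∏ ε α m) (pochhammer-∏ ε β m)) (≈-sym (∏<-· m _ _))

    module _ (r : Residue) where
      open Residue r using (low; high)

      -- Factors 2 j and 2 j + 1 of the progressions modulo 25 make up block j modulo 50; hence the
      -- length 2 N.
      thetaProduct-negative : thetaProduct -1ℤ low high (N * 2) ≈[ N ] residueProduct (residues r)
      thetaProduct-negative = ≈-trans (thetaProduct-∏ -1ℤ low high (N * 2)) (≈-trans (∏<-* N 2 _) (∏<-cong N block))
        where
        φ = factor -1ℤ
        0mod2 : ∀ a j → a + (0 + j * 2) * 25 ≡ a + j * 50
        0mod2 = solve-∀
        1mod2 : ∀ a j → a + (1 + j * 2) * 25 ≡ 25 + a + j * 50
        1mod2 = solve-∀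
        block : ∀ j → ∏< 2 (λ i → φ (low + (i + j * 2) * 25) · φ (high + (i + j * 2) * 25)) ≈[ N ]
                ∏ (residues r) (λ x → φ (x + j * 50))
        block j = ≈-trans
          (solve 4 (λ a b c d → (con 1 :* (a :* b)) :* (c :* d) := a :* (b :* (c :* (d :* con 1)))) ≈-refl _ _ _ _)
          (*-cong (≈-reflexive (cong φ (0mod2 low j))) (*-cong (≈-reflexive (cong φ (0mod2 high j)))
            (*-cong (≈-reflexive (cong φ (1mod2 low j))) (*-congʳ (≈-reflexive (cong φ (1mod2 high j)))))))

      thetaProduct-mixed : thetaProduct -1ℤ low high (N * 2) · thetaProduct 1ℤ low high (N * 2) ≈[ N ]
                           residueProduct (double r)
      thetaProduct-mixed = begin
        thetaProduct -1ℤ low high (N * 2) · thetaProduct 1ℤ low high (N * 2)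
          ≈⟨ *-cong (thetaProduct-∏ -1ℤ low high (N * 2)) (thetaProduct-∏ 1ℤ low high (N * 2)) ⟩
        ∏< (N * 2) (λ j → φ -1ℤ (low + j * 25) · φ -1ℤ (high + j * 25))
          · ∏< (N * 2) (λ j → φ 1ℤ (low + j * 25) · φ 1ℤ (high + j * 25))
          ≈⟨ ∏<-· (N * 2) _ _ ⟨
        ∏< (N * 2) (λ j → (φ -1ℤ (low + j * 25) · φ -1ℤ (high + j * 25)) · (φ 1ℤ (low + j * 25) · φ 1ℤ (high + j * 25)))
          ≈⟨ ∏<-cong (N * 2) (λ j → ≈-trans
               (solve 4 (λ a b c d → (a :* b) :* (c :* d) := (a :* c) :* ((b :* d) :* con 1)) ≈-refl _ _ _ _)
               (*-cong (square low j) (*-congʳ (square high j)))) ⟩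
        ∏< (N * 2) (λ j → ∏ (double r) (λ x → φ -1ℤ (x + j * 50)))
          ≡⟨ cong (λ m → ∏< m (λ j → ∏ (double r) (λ x → φ -1ℤ (x + j * 50)))) (N*2≡N+N N) ⟩
        ∏< (N + N) (λ j → ∏ (double r) (λ x → φ -1ℤ (x + j * 50)))
          ≈⟨ ∏<-unit N N (λ j N≤j → ≈-trans (*-cong (tail low j N≤j) (*-congʳ (tail high j N≤j)))
               (≈-trans (*-identityˡ _) (*-identityˡ _))) ⟩
        residueProduct (double r) ∎
        where
        φ = factor
        N*2≡N+N : ∀ N → N * 2 ≡ N + N
        N*2≡N+N = solve-∀
        exponents : ∀ a j → (a + j * 25) + (a + j * 25) ≡ (a + a) + j * 50
        exponents = solve-∀
        square : ∀ a j → φ -1ℤ (a + j * 25) · φ 1ℤ (a + j * 25) ≈[ N ] φ -1ℤ ((a + a) + j * 50)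
        square a j = begin
          (𝟏 ⊕ m₋) · (𝟏 ⊕ m₊)
            ≈⟨ solve 2 (λ m₋ m₊ → (con 1 :+ m₋) :* (con 1 :+ m₊) := (con 1 :+ m₋ :* m₊) :+ (m₊ :+ m₋)) ≈-refl m₋ m₊ ⟩
          (𝟏 ⊕ m₋ · m₊) ⊕ (m₊ ⊕ m₋)
            ≈⟨ ≈-trans (+-congˡ (exact (monomial-cancel s))) (+-identityʳ _) ⟩
          𝟏 ⊕ m₋ · m₊
            ≈⟨ +-congˡ (exact λ n → trans (monomial-·-monomial -1ℤ s 1ℤ s n)
                 (cong (λ e → monomial -1ℤ e n) (exponents a j))) ⟩
          φ -1ℤ ((a + a) + j * 50) ∎
          where
          s = a + j * 25
          m₋ = monomial -1ℤ s
          m₊ = monomial 1ℤ s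
        tail : ∀ a j → N ≤ j → φ -1ℤ ((a + a) + j * 50) ≈[ N ] 𝟏
        tail a j N≤j = 1+monomial≈1 -1ℤ (ℕ.≤-trans N≤j (ℕ.≤-trans (ℕ.m≤m*n j 50) (ℕ.m≤n+m (j * 50) (a + a))))

  open _≈[_]_

  pmSet-periodic : ∀ rs i j → pmSet 50 rs (suc i + j * 50) ≡ pmSet 50 rs (suc i)
  pmSet-periodic rs i j = cong or (map-cong (λ r → cong₂ (λ a b → (a ≡ᵇ (r % 50)) ∨ (b ≡ᵇ 0))
    ([m+kn]%n≡m%n (suc i) j 50)
    (trans (cong (_% 50) (swap (suc i) (j * 50) r)) ([m+kn]%n≡m%n (suc i + r) j 50))) rs)
    where
    swap : ∀ a b c → a + b + c ≡ a + c + b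
    swap = solve-∀

  -- Representatives run over 1, ..., 50 and not 0, ..., 49, so that x + 50 j with j ≥ 0 meets every
  -- positive integer once and never 0.
  members : List ℕ → List ℕ
  members rs = filterᵇ (pmSet 50 rs) (applyUpTo suc 50)

  residues₄ doubles₄ : Residues → List ℕ
  residues₄ (r₁ , r₂ , r₃ , r₄) = residues r₁ ++ residues r₂ ++ residues r₃ ++ residues r₄
  doubles₄ (r₁ , r₂ , r₃ , r₄) = double r₁ ++ double r₂ ++ double r₃ ++ double r₄

  -- Decides by evaluation that two closed lists of residues agree as multisets.
  sort-≡⇒↭ : ∀ {xs ys} → sort xs ≡ sort ys → xs ↭ ys
  sort-≡⇒↭ {xs} {ys} eq = ↭-trans (↭-sym (sort-↭ xs)) (↭-trans (↭-reflexive eq) (sort-↭ ys))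

  module _ (N : ℕ) where
    open CommutativeSemiring (truncatedSeries N)
      using (setoid; *-congˡ; *-congʳ; *-cong; +-cong; +-congˡ; +-congʳ; *-identityˡ; *-identityʳ; *-assoc; *-comm; *-commutativeMonoid)
      renaming (refl to ≈-refl; sym to ≈-sym; trans to ≈-trans; reflexive to ≈-reflexive)
    open SetoidReasoning setoid
    open SemiringSolver (truncatedSeries N) using (solve; _:=_; _:*_; _:+_; con)
    open BigOperators *-commutativeMonoid using () renaming
      ( ⨁-filter to ∏-filter; ⨁< to ∏<; ⨁<-cong to ∏<-cong; ⨁<-* to ∏<-*; ⨁<-⨁-applyUpTo to ∏<-∏-applyUpTo )

    private
      big : List ℕ → Series
      big = residueProduct N

    partFactor-residueProduct : ∀ rs → ∏< (N * 50) (partFactor (pmSet 50 rs) ∘ suc) ≈[ N ] big (members rs)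
    partFactor-residueProduct rs = ≈-trans (∏<-* N 50 _) (∏<-cong N λ j → ≈-trans
      (∏<-cong 50 (λ i → ≈-reflexive
        (cong (λ b → if b then factor -1ℤ (suc i + j * 50) else 𝟏) (pmSet-periodic rs i j))))
      (≈-trans (∏<-∏-applyUpTo suc 50 (λ x → if pmSet 50 rs x then factor -1ℤ (x + j * 50) else 𝟏))
        (∏-filter (pmSet 50 rs) (applyUpTo suc 50) _)))

    residueProduct-++₄ : ∀ ws xs ys zs → big (ws ++ xs ++ ys ++ zs) ≈[ N ] big ws · (big xs · (big ys · big zs))
    residueProduct-++₄ ws xs ys zs = ≈-trans (residueProduct-++ N ws _)
      (*-congˡ (≈-trans (residueProduct-++ N xs _) (*-congˡ (residueProduct-++ N ys zs))))

    thetaProduct₄-negative : ∀ R → thetaProduct₄ -1ℤ (N * 2) R ≈[ N ] big (residues₄ R)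
    thetaProduct₄-negative (r₁ , r₂ , r₃ , r₄) = ≈-trans
      (*-cong (thetaProduct-negative N r₁) (*-cong (thetaProduct-negative N r₂)
        (*-cong (thetaProduct-negative N r₃) (thetaProduct-negative N r₄))))
      (≈-sym (residueProduct-++₄ (residues r₁) (residues r₂) (residues r₃) (residues r₄)))

    thetaProduct₄-mixed : ∀ R → thetaProduct₄ -1ℤ (N * 2) R · thetaProduct₄ 1ℤ (N * 2) R ≈[ N ] big (doubles₄ R)
    thetaProduct₄-mixed (r₁ , r₂ , r₃ , r₄) = ≈-trans
      (solve 8 (λ a b c d a′ b′ c′ d′ → (a :* (b :* (c :* d))) :* (a′ :* (b′ :* (c′ :* d′)))
        := (a :* a′) :* ((b :* b′) :* ((c :* c′) :* (d :* d′)))) ≈-refl _ _ _ _ _ _ _ _)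
      (≈-trans (*-cong (thetaProduct-mixed N r₁) (*-cong (thetaProduct-mixed N r₂)
        (*-cong (thetaProduct-mixed N r₃) (thetaProduct-mixed N r₄))))
      (≈-sym (residueProduct-++₄ (double r₁) (double r₂) (double r₃) (double r₄))))

    module _ {y z P Q C}
      (theta : thetaProduct₄ 1ℤ (N * 2) P ≈[ N ]
               monomial 1ℤ y · thetaProduct₄ 1ℤ (N * 2) Q ⊕ monomial 1ℤ z · thetaProduct₄ -1ℤ (N * 2) C) where

      -- The theta relation multiplied by the θ₋ products of P and Q: each θ₊ meets its θ₋, and only
      -- factors 1 - q^n remain.
      product-relation : big (doubles₄ P ++ residues₄ Q) ≈[ N ]
        monomial 1ℤ y · big (doubles₄ Q ++ residues₄ P) ⊕ monomial 1ℤ z · big (residues₄ C ++ residues₄ P ++ residues₄ Q)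
      product-relation = begin
        big (doubles₄ P ++ residues₄ Q)
          ≈⟨ merge P Q ⟨
        (minus P · plus P) · minus Q
          ≈⟨ *-congʳ (*-congˡ theta) ⟩
        (minus P · (𝑦 · plus Q ⊕ 𝑧 · minus C)) · minus Q
          ≈⟨ solve 6 (λ y z p q q′ c → (p :* (y :* q′ :+ z :* c)) :* q := y :* ((q :* q′) :* p) :+ z :* (c :* (p :* q)))
               ≈-refl 𝑦 𝑧 (minus P) (minus Q) (plus Q) (minus C) ⟩
        𝑦 · ((minus Q · plus Q) · minus P) ⊕ 𝑧 · (minus C · (minus P · minus Q))
          ≈⟨ +-cong (*-congˡ (merge Q P)) (*-congˡ (≈-trans
               (*-cong (thetaProduct₄-negative C) (≈-trans
                 (*-cong (thetaProduct₄-negative P) (thetaProduct₄-negative Q))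
                 (≈-sym (residueProduct-++ N (residues₄ P) (residues₄ Q)))))
               (≈-sym (residueProduct-++ N (residues₄ C) (residues₄ P ++ residues₄ Q))))) ⟩
        𝑦 · big (doubles₄ Q ++ residues₄ P) ⊕ 𝑧 · big (residues₄ C ++ residues₄ P ++ residues₄ Q) ∎
        where
        𝑦 = monomial 1ℤ y
        𝑧 = monomial 1ℤ z
        minus plus : Residues → Series
        minus = thetaProduct₄ -1ℤ (N * 2)
        plus  = thetaProduct₄ 1ℤ (N * 2)
        merge : ∀ R R′ → (minus R · plus R) · minus R′ ≈[ N ] big (doubles₄ R ++ residues₄ R′)
        merge R R′ = ≈-trans (*-cong (thetaProduct₄-mixed R) (thetaProduct₄-negative R′))
          (≈-sym (residueProduct-++ N (doubles₄ R) (residues₄ R′)))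

      module _ {K W S T : List ℕ} (K≥1 : All (1 ≤_) K)
        (↭₁ : (doubles₄ P ++ residues₄ Q) ++ W ↭ K ++ members T)
        (↭₂ : (doubles₄ Q ++ residues₄ P) ++ W ↭ K ++ members S)
        (↭₃ : (residues₄ C ++ residues₄ P ++ residues₄ Q) ++ W ↭ K ++ members S ++ members T) where

        -- After multiplication by the W product, each of the three terms contains the K product.
        -- The latter has constant coefficient 1, since no element of K is 0, and cancels.
        cancelled-relation : big (members T) ≈[ N ]
          monomial 1ℤ y · big (members S) ⊕ monomial 1ℤ z · (big (members S) · big (members T))
        cancelled-relation = ·-cancelˡ (residueProduct-constant N K≥1) (begin
          big K · big (members T)
            ≈⟨ ≈-trans (≈-sym (residueProduct-++ N K (members T))) (≈-sym (regroup _ ↭₁)) ⟩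
          big L₁ · big W
            ≈⟨ *-congʳ product-relation ⟩
          (𝑦 · big L₂ ⊕ 𝑧 · big L₃) · big W
            ≈⟨ solve 5 (λ y a z b w → (y :* a :+ z :* b) :* w := y :* (a :* w) :+ z :* (b :* w)) ≈-refl 𝑦 (big L₂) 𝑧 (big L₃) (big W) ⟩
          𝑦 · (big L₂ · big W) ⊕ 𝑧 · (big L₃ · big W)
            ≈⟨ +-cong (*-congˡ (≈-trans (regroup L₂ ↭₂) (residueProduct-++ N K (members S))))
                 (*-congˡ (≈-trans (regroup L₃ ↭₃) (≈-trans (residueProduct-++ N K _) (*-congˡ (residueProduct-++ N (members S) (members T)))))) ⟩
          𝑦 · (big K · big (members S)) ⊕ 𝑧 · (big K · (big (members S) · big (members T)))
            ≈⟨ solve 5 (λ y k s z t → y :* (k :* s) :+ z :* (k :* (s :* t)) := k :* (y :* s :+ z :* (s :* t))) ≈-refl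
                 𝑦 (big K) (big (members S)) 𝑧 (big (members T)) ⟩
          big K · (𝑦 · big (members S) ⊕ 𝑧 · (big (members S) · big (members T))) ∎)
          where
          𝑦 = monomial 1ℤ y
          𝑧 = monomial 1ℤ z
          L₁ = doubles₄ P ++ residues₄ Q
          L₂ = doubles₄ Q ++ residues₄ P
          L₃ = residues₄ C ++ residues₄ P ++ residues₄ Q
          regroup : ∀ L {M} → L ++ W ↭ M → big L · big W ≈[ N ] big M
          regroup L L++W↭M = ≈-trans (≈-sym (residueProduct-++ N L W)) (residueProduct-↭ N L++W↭M)

        -- The generating functions invert the products over S and T, so multiplying by both of them
        -- divides the previous relation by these products.
        generating-relation : generating (pmSet 50 S) (N * 50) ≈[ N ]
          monomial 1ℤ y · generating (pmSet 50 T) (N * 50) ⊕ monomial 1ℤ z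
        generating-relation = begin
          gS
            ≈⟨ ≈-trans (≈-sym (*-identityʳ gS)) (*-congˡ (≈-sym T-inverse)) ⟩
          gS · (bT · gT)
            ≈⟨ *-congˡ (*-congʳ cancelled-relation) ⟩
          gS · ((𝑦 · bS ⊕ 𝑧 · (bS · bT)) · gT)
            ≈⟨ solve 6 (λ y z g s t h → g :* ((y :* s :+ z :* (s :* t)) :* h) :=
                 (y :* h) :* (s :* g) :+ z :* ((s :* g) :* (t :* h))) ≈-refl 𝑦 𝑧 gS bS bT gT ⟩
          (𝑦 · gT) · (bS · gS) ⊕ 𝑧 · ((bS · gS) · (bT · gT))
            ≈⟨ +-cong (≈-trans (*-congˡ S-inverse) (*-identityʳ _))
                 (≈-trans (*-congˡ (≈-trans (*-cong S-inverse T-inverse) (*-identityʳ _))) (*-identityʳ _)) ⟩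
          𝑦 · gT ⊕ 𝑧 ∎
          where
          𝑦 = monomial 1ℤ y
          𝑧 = monomial 1ℤ z
          gS = generating (pmSet 50 S) (N * 50)
          gT = generating (pmSet 50 T) (N * 50)
          bS = big (members S)
          bT = big (members T)
          inverse : ∀ rs → big (members rs) · generating (pmSet 50 rs) (N * 50) ≈[ N ] 𝟏
          inverse rs = ≈-trans (*-congʳ (≈-sym (partFactor-residueProduct rs))) (generating-inverse N (pmSet 50 rs) (N * 50))
          S-inverse = inverse S
          T-inverse = inverse T

  generating-p : ∀ S {N n} → n < N → generating S (N * 50) n ≡ + p S n
  generating-p S {N} {n} n<N = cong +_ (trans
    (cong (λ k → pLe S k n) (sym (ℕ.m∸n+n≡m (ℕ.≤-trans (ℕ.<⇒≤ n<N) (ℕ.m≤m*n N 50)))))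
    (pLe-stable S (N * 50 ∸ n) n))

  -- Precision n + 1 suffices to read off the coefficient of q^n, where q^z contributes only if n =
  -- z.
  shifted-identity : ∀ {S T y z} →
    (∀ N → generating S (N * 50) ≈[ N ] monomial 1ℤ y · generating T (N * 50) ⊕ monomial 1ℤ z) →
    ∀ n → y ≤ n → n ≢ z → p S n ≡ p T (n ∸ y)
  shifted-identity {S} {T} {y} {z} relation n y≤n n≢z = ℤ.+-injective (begin
    + p S n                                       ≡⟨ generating-p S {N} ℕ.≤-refl ⟨
    generating S (N * 50) n                       ≡⟨ coefficient (relation N) n ℕ.≤-refl ⟩
    (monomial 1ℤ y · g ⊕ monomial 1ℤ z) n         ≡⟨ ⊕-coefficient (monomial 1ℤ y · g) (monomial 1ℤ z) n ⟩
    (monomial 1ℤ y · g) n ℤ.+ monomial 1ℤ z n     ≡⟨ cong₂ ℤ._+_ (cong (monomial 1ℤ y · g) (sym (ℕ.m+[n∸m]≡n y≤n))) (monomial-≢ 1ℤ z n≢z) ⟩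
    (monomial 1ℤ y · g) (y + (n ∸ y)) ℤ.+ 0ℤ      ≡⟨ ℤ.+-identityʳ _ ⟩
    (monomial 1ℤ y · g) (y + (n ∸ y))             ≡⟨ monomial-·-+ 1ℤ y g (n ∸ y) ⟩
    1ℤ ℤ.* g (n ∸ y)                              ≡⟨ ℤ.*-identityˡ _ ⟩
    g (n ∸ y)                                     ≡⟨ generating-p T {N} (s≤s (ℕ.m∸n≤m n y)) ⟩
    + p T (n ∸ y)                                 ∎)
    where
    open ≡-Reasoning
    N = suc n
    g = generating T (N * 50)

  -- The five identities

  residue : ∀ α → suc (α ∸ 1) + suc (24 ∸ α) ≡ 25 → Residue
  residue α = residuePair (α ∸ 1) (24 ∸ α)

  plusMinus : List ℕ → List ℕ
  plusMinus rs = rs ++ map (50 ∸_) rs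

  -- K is the factor cancelled on both sides, and W the set of residues common to S and T.
  partition-identity : ∀ {π π̄ ρ ρ̄ y z S T} → Classes π π̄ → Classes ρ ρ̄ → ∀ P Q C e₁ f₁ e₂ f₂ e₃ f₃ →
    Reflection 0 (oppositeFirst P) π z C 0ℤ e₁ f₁ →
    Reflection z C 0ℤ 0 (oppositeFirst P) π (complement f₁ e₁) f₁ →
    Reflection 0 P π̄ y Q ρ e₂ f₂ →
    Reflection y Q ρ 0 P π̄ (complement f₂ e₂) f₂ →
    Reflection y (oppositeFirst Q) ρ̄ z (oppositeFirst C) 1ℤ e₃ f₃ →
    Reflection z (oppositeFirst C) 1ℤ y (oppositeFirst Q) ρ̄ (complement f₃ e₃) f₃ →
    ∀ K W {_ : True (all? (1 ≤?_) K)} →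
    (doubles₄ P ++ residues₄ Q) ++ W ↭ K ++ members T →
    (doubles₄ Q ++ residues₄ P) ++ W ↭ K ++ members S →
    (residues₄ C ++ residues₄ P ++ residues₄ Q) ++ W ↭ K ++ members S ++ members T →
    ∀ n → y ≤ n → n ≢ z → p (pmSet 50 S) n ≡ p (pmSet 50 T) (n ∸ y)
  partition-identity {y = y} {z} {S} {T} cπ cρ P Q C e₁ f₁ e₂ f₂ e₃ f₃ PC CP PQ QP QC CQ K W {K≥1} ↭₁ ↭₂ ↭₃ =
    shifted-identity {y = y} {z} λ N → generating-relation N {y} {z} {P} {Q} {C}
      (theta-relation {y = y} {z} {P} {Q} {C} cπ cρ PC CP PQ QP QC CQ N (N * 2) (ℕ.m≤m*n N 2))
      {K} {W} {S} {T} (toWitness K≥1) ↭₁ ↭₂ ↭₃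

  -- Q and C are computed from P. The slopes 2 r - 25 of P, reflected in the half π̄, give those of
  -- Q; reflected in the half π after a sign change of the first, they give those of C. The entries
  -- of e count the multiples of 50 that bring the reflected slopes back between -25 and 25, and f
  -- is half of π + Σ e, rounded down. All conditions become equations between closed integers.
  identity₁ : ∀ n → 1 ≤ n → n ≢ 0 →
    p (pmSet 50 (1 ∷ 6 ∷ 7 ∷ 8 ∷ 9 ∷ 11 ∷ 12 ∷ 13 ∷ 16 ∷ 17 ∷ 19 ∷ 23 ∷ [])) n ≡
    p (pmSet 50 (1 ∷ 5 ∷ 6 ∷ 7 ∷ 8 ∷ 11 ∷ 15 ∷ 17 ∷ 18 ∷ 19 ∷ 23 ∷ 24 ∷ [])) (n ∸ 1)
  identity₁ = partition-identity even-odd even-odd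
    (residue 1 refl , residue 7 refl , residue 9 refl , residue 12 refl)
    (residue 24 refl , residue 5 refl , residue 7 refl , residue 10 refl)
    (residue 23 refl , residue 6 refl , residue 8 refl , residue 11 refl)
    -- In the odd half of P, s = 25 - 21 = 4 takes the first slope from -23 to -27; e₁ = -1 brings
    -- it back to 23, the slope of the residue 24.
    (0ℤ , 0ℤ , 0ℤ , 0ℤ) 0ℤ (-1ℤ , 0ℤ , 0ℤ , 0ℤ) 0ℤ (0ℤ , 0ℤ , 0ℤ , 0ℤ) 0ℤ
    (reflection refl refl refl refl refl refl refl) (reflection refl refl refl refl refl refl refl)
    (reflection refl refl refl refl refl refl refl) (reflection refl refl refl refl refl refl refl)
    (reflection refl refl refl refl refl refl refl) (reflection refl refl refl refl refl refl refl)
    (plusMinus (1 ∷ 2 ∷ 7 ∷ 10 ∷ 14 ∷ 18 ∷ 20 ∷ 24 ∷ [])) (plusMinus (1 ∷ 6 ∷ 7 ∷ 8 ∷ 11 ∷ 17 ∷ 19 ∷ 23 ∷ []))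
    (sort-≡⇒↭ refl) (sort-≡⇒↭ refl) (sort-≡⇒↭ refl)

  identity₂ : ∀ n → 1 ≤ n → n ≢ 0 →
    p (pmSet 50 (1 ∷ 3 ∷ 4 ∷ 5 ∷ 7 ∷ 15 ∷ 17 ∷ 18 ∷ 19 ∷ 21 ∷ 22 ∷ 24 ∷ [])) n ≡
    p (pmSet 50 (1 ∷ 2 ∷ 3 ∷ 7 ∷ 11 ∷ 14 ∷ 17 ∷ 18 ∷ 19 ∷ 21 ∷ 23 ∷ 24 ∷ [])) (n ∸ 1)
  identity₂ = partition-identity even-odd odd-even
    (residue 3 refl , residue 4 refl , residue 5 refl , residue 15 refl)
    (residue 2 refl , residue 3 refl , residue 4 refl , residue 14 refl)
    (residue 24 refl , residue 6 refl , residue 7 refl , residue 17 refl)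
    (0ℤ , 0ℤ , 0ℤ , 0ℤ) 0ℤ (0ℤ , 0ℤ , 0ℤ , 0ℤ) 0ℤ (1ℤ , 0ℤ , 0ℤ , 0ℤ) 0ℤ
    (reflection refl refl refl refl refl refl refl) (reflection refl refl refl refl refl refl refl)
    (reflection refl refl refl refl refl refl refl) (reflection refl refl refl refl refl refl refl)
    (reflection refl refl refl refl refl refl refl) (reflection refl refl refl refl refl refl refl)
    (plusMinus (3 ∷ 4 ∷ 6 ∷ 8 ∷ 10 ∷ 20 ∷ 21 ∷ 22 ∷ [])) (plusMinus (1 ∷ 3 ∷ 7 ∷ 17 ∷ 18 ∷ 19 ∷ 21 ∷ 24 ∷ []))
    (sort-≡⇒↭ refl) (sort-≡⇒↭ refl) (sort-≡⇒↭ refl)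

  -- With y = 0 the monomial q^5 lies in the range of n: the two counts differ by one at n = 5.
  identity₃ : ∀ n → 0 ≤ n → n ≢ 5 →
    p (pmSet 50 (1 ∷ 3 ∷ 4 ∷ 5 ∷ 7 ∷ 9 ∷ 12 ∷ 13 ∷ 15 ∷ 16 ∷ 21 ∷ 22 ∷ [])) n ≡
    p (pmSet 50 (1 ∷ 3 ∷ 4 ∷ 6 ∷ 7 ∷ 8 ∷ 9 ∷ 13 ∷ 17 ∷ 19 ∷ 21 ∷ 22 ∷ [])) (n ∸ 0)
  identity₃ = partition-identity odd-even even-odd
    (residue 12 refl , residue 10 refl , residue 9 refl , residue 5 refl)
    (residue 19 refl , residue 17 refl , residue 16 refl , residue 12 refl)
    (residue 7 refl , residue 4 refl , residue 3 refl , residue 24 refl)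
    -- In the last reflection two slopes leave the range, so the parity condition reads 1 - 2 = 2 f
    -- + 1 and f = -1.
    (0ℤ , 0ℤ , 0ℤ , -1ℤ) 0ℤ (0ℤ , 0ℤ , 0ℤ , 0ℤ) 0ℤ (-1ℤ , 0ℤ , 0ℤ , -1ℤ) -1ℤ
    (reflection refl refl refl refl refl refl refl) (reflection refl refl refl refl refl refl refl)
    (reflection refl refl refl refl refl refl refl) (reflection refl refl refl refl refl refl refl)
    (reflection refl refl refl refl refl refl refl) (reflection refl refl refl refl refl refl refl)
    (plusMinus (9 ∷ 10 ∷ 12 ∷ 13 ∷ 16 ∷ 18 ∷ 20 ∷ 24 ∷ [])) (plusMinus (1 ∷ 3 ∷ 4 ∷ 7 ∷ 9 ∷ 13 ∷ 21 ∷ 22 ∷ []))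
    (sort-≡⇒↭ refl) (sort-≡⇒↭ refl) (sort-≡⇒↭ refl)

  identity₄ : ∀ n → 2 ≤ n → n ≢ 0 →
    p (pmSet 50 (2 ∷ 3 ∷ 5 ∷ 9 ∷ 11 ∷ 12 ∷ 13 ∷ 14 ∷ 15 ∷ 16 ∷ 21 ∷ 23 ∷ [])) n ≡
    p (pmSet 50 (1 ∷ 3 ∷ 7 ∷ 9 ∷ 11 ∷ 12 ∷ 13 ∷ 16 ∷ 18 ∷ 21 ∷ 23 ∷ 24 ∷ [])) (n ∸ 2)
  identity₄ = partition-identity even-odd even-odd
    (residue 2 refl , residue 15 refl , residue 11 refl , residue 5 refl)
    (residue 23 refl , residue 11 refl , residue 7 refl , residue 1 refl)
    (residue 21 refl , residue 13 refl , residue 9 refl , residue 3 refl)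
    (0ℤ , 0ℤ , 0ℤ , 0ℤ) 0ℤ (-1ℤ , 0ℤ , 0ℤ , 0ℤ) 0ℤ (0ℤ , 0ℤ , 0ℤ , 0ℤ) 0ℤ
    (reflection refl refl refl refl refl refl refl) (reflection refl refl refl refl refl refl refl)
    (reflection refl refl refl refl refl refl refl) (reflection refl refl refl refl refl refl refl)
    (reflection refl refl refl refl refl refl refl) (reflection refl refl refl refl refl refl refl)
    (plusMinus (2 ∷ 4 ∷ 10 ∷ 11 ∷ 14 ∷ 20 ∷ 22 ∷ 23 ∷ [])) (plusMinus (3 ∷ 9 ∷ 11 ∷ 12 ∷ 13 ∷ 16 ∷ 21 ∷ 23 ∷ []))
    (sort-≡⇒↭ refl) (sort-≡⇒↭ refl) (sort-≡⇒↭ refl)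

  identity₅ : ∀ n → 2 ≤ n → n ≢ 0 →
    p (pmSet 50 (2 ∷ 5 ∷ 6 ∷ 8 ∷ 9 ∷ 11 ∷ 13 ∷ 14 ∷ 15 ∷ 17 ∷ 19 ∷ 23 ∷ [])) n ≡
    p (pmSet 50 (2 ∷ 3 ∷ 4 ∷ 9 ∷ 11 ∷ 13 ∷ 14 ∷ 17 ∷ 19 ∷ 21 ∷ 22 ∷ 23 ∷ [])) (n ∸ 2)
  identity₅ = partition-identity even-odd odd-even
    (residue 8 refl , residue 6 refl , residue 5 refl , residue 10 refl)
    (residue 6 refl , residue 4 refl , residue 3 refl , residue 8 refl)
    (residue 23 refl , residue 12 refl , residue 11 refl , residue 16 refl)
    (0ℤ , 0ℤ , 0ℤ , 0ℤ) 0ℤ (0ℤ , 0ℤ , 0ℤ , 0ℤ) 0ℤ (1ℤ , 0ℤ , 0ℤ , 0ℤ) 0ℤ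
    (reflection refl refl refl refl refl refl refl) (reflection refl refl refl refl refl refl refl)
    (reflection refl refl refl refl refl refl refl) (reflection refl refl refl refl refl refl refl)
    (reflection refl refl refl refl refl refl refl) (reflection refl refl refl refl refl refl refl)
    (plusMinus (6 ∷ 8 ∷ 10 ∷ 12 ∷ 16 ∷ 17 ∷ 19 ∷ 20 ∷ [])) (plusMinus (2 ∷ 9 ∷ 11 ∷ 13 ∷ 14 ∷ 17 ∷ 19 ∷ 23 ∷ []))
    (sort-≡⇒↭ refl) (sort-≡⇒↭ refl) (sort-≡⇒↭ refl)

theorem8p2 : ((n : ℕ) → 1 ≤ n →
    p (pmSet 50 (1 ∷ 6 ∷ 7 ∷ 8 ∷ 9 ∷ 11 ∷ 12 ∷ 13 ∷ 16 ∷ 17 ∷ 19 ∷ 23 ∷ [])) n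
    ≡ p (pmSet 50 (1 ∷ 5 ∷ 6 ∷ 7 ∷ 8 ∷ 11 ∷ 15 ∷ 17 ∷ 18 ∷ 19 ∷ 23 ∷ 24 ∷ [])) (n ∸ 1))
    × ((n : ℕ) → 1 ≤ n →
    p (pmSet 50 (1 ∷ 3 ∷ 4 ∷ 5 ∷ 7 ∷ 15 ∷ 17 ∷ 18 ∷ 19 ∷ 21 ∷ 22 ∷ 24 ∷ [])) n
    ≡ p (pmSet 50 (1 ∷ 2 ∷ 3 ∷ 7 ∷ 11 ∷ 14 ∷ 17 ∷ 18 ∷ 19 ∷ 21 ∷ 23 ∷ 24 ∷ [])) (n ∸ 1))
    × ((n : ℕ) → n ≢ 5 →
    p (pmSet 50 (1 ∷ 3 ∷ 4 ∷ 5 ∷ 7 ∷ 9 ∷ 12 ∷ 13 ∷ 15 ∷ 16 ∷ 21 ∷ 22 ∷ [])) n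
    ≡ p (pmSet 50 (1 ∷ 3 ∷ 4 ∷ 6 ∷ 7 ∷ 8 ∷ 9 ∷ 13 ∷ 17 ∷ 19 ∷ 21 ∷ 22 ∷ [])) n)
    × ((n : ℕ) → 2 ≤ n →
    p (pmSet 50 (2 ∷ 3 ∷ 5 ∷ 9 ∷ 11 ∷ 12 ∷ 13 ∷ 14 ∷ 15 ∷ 16 ∷ 21 ∷ 23 ∷ [])) n
    ≡ p (pmSet 50 (1 ∷ 3 ∷ 7 ∷ 9 ∷ 11 ∷ 12 ∷ 13 ∷ 16 ∷ 18 ∷ 21 ∷ 23 ∷ 24 ∷ [])) (n ∸ 2))
    × ((n : ℕ) → 2 ≤ n →
    p (pmSet 50 (2 ∷ 5 ∷ 6 ∷ 8 ∷ 9 ∷ 11 ∷ 13 ∷ 14 ∷ 15 ∷ 17 ∷ 19 ∷ 23 ∷ [])) n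
    ≡ p (pmSet 50 (2 ∷ 3 ∷ 4 ∷ 9 ∷ 11 ∷ 13 ∷ 14 ∷ 17 ∷ 19 ∷ 21 ∷ 22 ∷ 23 ∷ [])) (n ∸ 2))
theorem8p2 =
    (λ n 1≤n → identity₁ n 1≤n (ℕ.>⇒≢ 1≤n))
  , (λ n 1≤n → identity₂ n 1≤n (ℕ.>⇒≢ 1≤n))
  , (λ n n≢5 → identity₃ n z≤n n≢5)
  , (λ n 2≤n → identity₄ n 2≤n (ℕ.>⇒≢ (ℕ.<⇒≤ 2≤n)))
  , (λ n 2≤n → identity₅ n 2≤n (ℕ.>⇒≢ (ℕ.<⇒≤ 2≤n)))
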